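{- Let $X\subset\mathbb{R}$ be a known finite set with $|X|\ge 2$ and metric $|x-y|$. The dyadic anchor-exploration algorithm (defined in the context) is $84$-competitive for blind elective online service on $X$ with unit waiting times and observable hits: $\operatorname{ALG}(I)\le 84\operatorname{OPT}(I)$ for every finite input $I$, where $\operatorname{OPT}(I)$ is the clairvoyant elective offline optimum.
   Context: Model. The server starts at $s_0\in X$. An input $I$ is a finite set of request occurrences; each request $q$ has an arrival time $a(q)\ge 0$ and a location $x(q)\in X$. An arrival epoch is the set of all requests sharing one arrival time. A walk $P=(v_0,\ldots,v_\ell)$ in $X$ ($\ell\ge 0$) is executed instantaneously at one time, visits its listed vertices, and has length $\operatorname{len}(P)=\sum_i |v_{i-1}-v_i|$; monotone moves list all sites in between. A schedule is a finite sequence of atomic actions with nondecreasing timestamps. At time $t$ the complete epoch arriving at $t$ is processed first; then one action at $t$ performs a finite ordered sequence of walks (components), chosen adaptively from observations made earlier, and no arrival is interleaved until the action ends. The first walk starts at $s_0$ and every later one starts where its predecessor ended. A component walk $P$ at time $t$ during which a nonempty set $B$ of pending requests is served is one service event of cost $\operatorname{len}(P)+\max_{q\in B}(t-a(q))$; a component serving no request costs $\operatorname{len}(P)$. The cost of a schedule is the sum of these costs; every request must eventually be served. Elective service: a visited pending request may, but need not, be served. $\operatorname{OPT}(I)$ is the infimum of the cost over feasible elective schedules knowing the full input. Blind information: at arrival, a request's existence, persistent identity and waiting clock are revealed, but not its location. Visiting (or occupying) a location reveals every pending request there, with its identity; so the algorithm knows when every announced request has been discovered. Dyadic anchor-exploration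 algorithm. Let $\delta=\min\{|x-y|:x,y\in X,\ x\ne y\}$ and $r_j=2^j\delta$ for $j\ge 0$. Maintain an anchor $s$ (initially $s_0$) at which the server is parked between actions. After each complete arrival epoch, a zero-length check at $s$ is made and every request revealed there is served at once at zero cost and removed. A phase starts with the first epoch leaving unresolved identities after this check; its set $P$ consists of these identities and all identities arriving later in the phase and unresolved after their zero-check. Let $\alpha=\min_{q\in P}a(q)$. At times $\alpha+r_j$, $j=0,1,2,\ldots$ (after processing any epoch arriving at that time), make a closed sweep $s\to L_{r_j}\to R_{r_j}\to s$, where $L_{r_j},R_{r_j}$ are the extreme sites of $X\cap[s-r_j,s+r_j]$, serving no request but recording all discovered identities and locations. At the first such sweep after which every identity currently in $P$ has been discovered, immediately, as the next component of the same atomic action, let $L\le R$ be the extreme locations of requests in $P$; if $|s-R|\ge|s-L|$ walk $s\to L\to R$ and set $s\leftarrow R$, otherwise walk $s\to R\to L$ and set $s\leftarrow L$; serve all of $P$ in this one service event, and end the phase. -}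

module Defs where

open import Algebra.Bundles using (CommutativeRing)
open import Algebra.Structures using (IsCommutativeRing)
import Algebra.Construct.NaturalChoice.Max as Max
import Algebra.Construct.NaturalChoice.Min as Min
import Algebra.Definitions.RawMonoid as RawMonoid
open import Data.Bool.Base using (if_then_else_)
open import Data.Fin.Base using (Fin; zero; suc)
import Data.Fin.Base as Fin
import Data.Fin.Properties as Fin
open import Data.List.Base
  using (List; []; _∷_; _++_; map; filter; foldr; reverse; concatMap;
         allFin; cartesianProduct; deduplicate; find)
open import Data.List.NonEmpty.Base using (List⁺; _∷_; toList; foldr₁; head; last; _⁺++_)
import Data.List.NonEmpty.Base as List⁺
import Data.List.NonEmpty.Effectful as List⁺
import Data.List.Membership.DecPropositional as DecMembership
open import Data.List.Membership.Propositional using (_∈_; _∉_)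
open import Data.List.Membership.Propositional.Properties using (∈-map⁺; ∈-++⁺ˡ; ∈-allFin)
open import Data.List.Relation.Unary.All using (All; []; _∷_)
import Data.List.Relation.Unary.All as All
open import Data.List.Relation.Unary.Any using (here; there)
open import Data.List.Relation.Unary.Linked using (Linked; [-])
import Data.List.Sort as Sort
open import Data.Maybe.Base using (Maybe; just; nothing)
import Data.Maybe.Base as Maybe
import Data.Maybe.Effectful as Maybe
open import Data.Nat.Base using (ℕ)
import Data.Nat.Base as ℕ
open import Data.Product.Base using (Σ; ∃; _×_; _,_; proj₁; proj₂)
open import Data.Sum.Base using (inj₁; inj₂)
open import Function.Base using (_∘_)
open import Relation.Binary.Bundles using (DecTotalOrder)
open import Relation.Binary.Definitions using (DecidableEquality)
open import Relation.Binary.PropositionalEquality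
  using (_≡_; _≢_; refl; sym; trans; cong; subst; subst₂)
open import Relation.Binary.Structures using (IsDecTotalOrder)
open import Relation.Nullary.Decidable using (does; yes; no; ¬?; _×-dec_)
open import Relation.Nullary.Negation using (¬_)

-- The real numbers, axiomatised (up to isomorphism) as the complete ordered
-- field.  The order is decidable, as it is classically, and the Archimedean
-- property, classically a consequence of completeness, is listed separately.
record RealNumbers : Set₁ where
  infix  4 _≤_
  infixl 6 _+_ _-_
  infixl 7 _*_
  infix  8 -_
  field
    ℝ       : Set
    _≤_     : ℝ → ℝ → Set
    _+_ _*_ : ℝ → ℝ → ℝ
    -_      : ℝ → ℝ
    0# 1#   : ℝ
    isCommutativeRing : IsCommutativeRing _≡_ _+_ _*_ -_ 0# 1#
    isDecTotalOrder   : IsDecTotalOrder _≡_ _≤_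
    0≢1         : 0# ≢ 1#
    invertible  : ∀ x → x ≢ 0# → ∃ λ y → x * y ≡ 1#
    +-monoʳ-≤   : ∀ z {x y} → x ≤ y → z + x ≤ z + y
    *-nonneg    : ∀ {x y} → 0# ≤ x → 0# ≤ y → 0# ≤ x * y

  commutativeRing : CommutativeRing _ _
  commutativeRing = record { isCommutativeRing = isCommutativeRing }

  decTotalOrder : DecTotalOrder _ _ _
  decTotalOrder = record { isDecTotalOrder = isDecTotalOrder }

  open CommutativeRing commutativeRing public
    using (+-rawMonoid; +-comm; +-identityˡ; +-identityʳ; -‿inverseˡ; -‿inverseʳ)
  open DecTotalOrder decTotalOrder public
    using (_≤?_; _≟_; total; totalOrder)
    renaming (refl to ≤-refl; trans to ≤-trans)
  open RawMonoid +-rawMonoid public using () renaming (_×_ to _·_)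
  open Max totalOrder public using (_⊔_; x≤x⊔y; x≤y⊔x)
  open Min totalOrder public using (_⊓_)
  open Sort decTotalOrder public using (sort)

  _-_ : ℝ → ℝ → ℝ
  x - y = x + (- y)

  ∣_∣ : ℝ → ℝ
  ∣ x ∣ = x ⊔ (- x)

  IsLowerBound : (ℝ → Set) → ℝ → Set
  IsLowerBound A b = ∀ x → A x → b ≤ x

  IsInfimum : (ℝ → Set) → ℝ → Set
  IsInfimum A m = IsLowerBound A m × (∀ b → IsLowerBound A b → b ≤ m)

  field
    archimedean : ∀ x {y} → ¬ (y ≤ 0#) → ∃ λ n → x ≤ n · y
    complete    : ∀ (A : ℝ → Set) → ∃ A → ∃ (IsLowerBound A) → ∃ (IsInfimum A)

  0≤+ : ∀ {x y} → 0# ≤ x → 0# ≤ y → 0# ≤ x + y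
  0≤+ {x} {y} 0≤x 0≤y =
    ≤-trans 0≤x (subst (_≤ x + y) (+-identityʳ x) (+-monoʳ-≤ x 0≤y))

  0≤- : ∀ {x y} → y ≤ x → 0# ≤ x - y
  0≤- {x} {y} y≤x =
    subst₂ _≤_ (-‿inverseˡ y) (+-comm (- y) x) (+-monoʳ-≤ (- y) y≤x)

  0≤∣∣ : ∀ x → 0# ≤ ∣ x ∣
  0≤∣∣ x with total 0# x
  ... | inj₁ 0≤x = ≤-trans 0≤x (x≤x⊔y x (- x))
  ... | inj₂ x≤0 =
    ≤-trans (subst (0# ≤_) (+-identityˡ (- x)) (0≤- x≤0)) (x≤y⊔x x (- x))

-- A finite set of at least two reals, given by its increasing enumeration.
record FiniteSubset (R : RealNumbers) : Set where
  open RealNumbers R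
  field
    size-2     : ℕ
    coord      : Fin (ℕ.suc (ℕ.suc size-2)) → ℝ
    increasing : ∀ {i j} → i Fin.< j → coord i ≤ coord j × coord i ≢ coord j

module Line (R : RealNumbers) (X : FiniteSubset R) where
  open RealNumbers R
  open FiniteSubset X public

  Site : Set
  Site = Fin (ℕ.suc (ℕ.suc size-2))

  sites : List Site
  sites = allFin _

  open Min (Fin.≤-totalOrder (ℕ.suc (ℕ.suc size-2))) public using () renaming (_⊓_ to leftmost)
  open Max (Fin.≤-totalOrder (ℕ.suc (ℕ.suc size-2))) public using () renaming (_⊔_ to rightmost)

  dist : Site → Site → ℝ
  dist x y = ∣ coord x - coord y ∣

  -- The seed of the fold is itself the distance of two distinct sites.
  δ : ℝ
  δ = foldr _⊓_ (dist zero (suc zero))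
        (map (λ (x , y) → dist x y)
          (filter (λ (x , y) → ¬? (x Fin.≟ y)) (cartesianProduct sites sites)))

  radius : ℕ → ℝ
  radius j = (2 ℕ.^ j) · δ

  Walk : Set
  Walk = List⁺ Site

  lenFrom : Site → List Site → ℝ
  lenFrom v []       = 0#
  lenFrom v (w ∷ ws) = dist v w + lenFrom w ws

  len : Walk → ℝ
  len (v ∷ ws) = lenFrom v ws

  -- All sites met by a monotone move from x to y, in order, without x itself.
  move : Site → Site → List Site
  move x y = if does (x Fin.≤? y)
    then filter (λ z → (x Fin.<? z) ×-dec (z Fin.≤? y)) sites
    else reverse (filter (λ z → (y Fin.≤? z) ×-dec (z Fin.<? x)) sites)

  moves : Site → List Site → List Site
  moves x []       = []
  moves x (y ∷ ys) = move x y ++ moves y ys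

  -- The concatenated monotone moves from x through the given turning points.
  route : Site → List Site → Walk
  route x ys = x ∷ moves x ys

  within : Site → ℝ → List Site
  within s r = filter (λ z → (coord s - r ≤? coord z) ×-dec (coord z ≤? coord s + r)) sites

  -- Since s lies in its own window, seeding the folds with s changes nothing.
  leftEnd rightEnd : Site → ℝ → Site
  leftEnd  s r = foldr leftmost  s (within s r)
  rightEnd s r = foldr rightmost s (within s r)

  record Component (Id : Set) : Set where
    constructor component
    field
      walk   : Walk
      serves : List Id

  record Action (Id : Set) : Set where
    constructor action
    field
      time       : ℝ
      components : List (Component Id)

  Schedule : Set → Set
  Schedule Id = List (Action Id)

-- The decision rules of the algorithm.  This module has no access to the
-- input: locations enter only through sightings, i.e. the pending requests
-- revealed by a walk.
module DyadicAnchorExploration (R : RealNumbers) (X : FiniteSubset R)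
                               {Id : Set} (_≟ᴵ_ : DecidableEquality Id) where
  open RealNumbers R
  open Line R X
  open DecMembership _≟ᴵ_ using () renaming (_∈?_ to _∈ᴵ?_)

  Sighting : Set
  Sighting = Id × Site

  identities : List Sighting → List Id
  identities = map proj₁

  record Phase : Set where
    field
      members    : List⁺ (Id × ℝ)   -- identities of P, with their arrival times
      sweepsDone : ℕ
      known      : List Sighting

    α : ℝ
    α = foldr₁ _⊓_ (List⁺.map proj₂ members)

    nextSweep : ℝ
    nextSweep = α + radius sweepsDone

    locate : Id → Maybe Site
    locate q = Maybe.map proj₂ (find (λ (p , _) → p ≟ᴵ q) known)

    -- The locations of all of P if every identity of P has been discovered,
    -- and nothing otherwise.
    locations : Maybe (List⁺ Site)
    locations = List⁺.TraversableA.mapA Maybe.applicative (locate ∘ proj₁) members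

  record State : Set where
    constructor state
    field
      anchor : Site
      phase  : Maybe Phase

  open Phase
  open State

  check : Site → Walk
  check s = s ∷ []

  unresolved : ℝ → List Id → List Sighting → List (Id × ℝ)
  unresolved t announced seen =
    map (_, t) (filter (λ q → ¬? (q ∈ᴵ? identities seen)) announced)

  extend : Maybe Phase → List (Id × ℝ) → Maybe Phase
  extend (just φ) us       = just (record φ { members = members φ ⁺++ us })
  extend nothing  []       = nothing
  extend nothing  (u ∷ us) = just (record { members = u ∷ us ; sweepsDone = 0 ; known = [] })

  afterCheck : State → ℝ → List Id → List Sighting → State
  afterCheck σ t announced seen =
    record σ { phase = extend (phase σ) (unresolved t announced seen) }

  sweep : Site → Phase → Walk
  sweep s φ = route s (leftEnd s r ∷ rightEnd s r ∷ s ∷ [])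
    where r = radius (sweepsDone φ)

  collect : Site → List⁺ Site → Walk × Site
  collect s ls = if does (dist s L ≤? dist s R′)
    then (route s (L ∷ R′ ∷ []) , R′)
    else (route s (R′ ∷ L ∷ []) , L)
    where
    L  = foldr₁ leftmost ls
    R′ = foldr₁ rightmost ls

  record-sweep : Phase → List Sighting → Phase
  record-sweep φ seen =
    record φ { sweepsDone = ℕ.suc (sweepsDone φ) ; known = known φ ++ seen }

  finish : Site → Phase → Maybe (List⁺ Site) → List (Component Id) × State
  finish s φ nothing   = [] , state s (just φ)
  finish s φ (just ls) = let (w , s′) = collect s ls in
    component w (map proj₁ (toList (members φ))) ∷ [] , state s′ nothing

  -- The components following a sweep in the same action, and the new state.
  afterSweep : Site → Phase → List Sighting → List (Component Id) × State
  afterSweep s φ seen = finish s (record-sweep φ seen) (locations (record-sweep φ seen))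

module BlindElectiveService (R : RealNumbers) (X : FiniteSubset R) (s₀ : Line.Site R X) where
  open RealNumbers R
  open Line R X
  open Component
  open Action

  record Input : Set where
    field
      requests  : ℕ
    Request : Set
    Request = Fin requests
    field
      arrival   : Request → ℝ
      arrival≥0 : ∀ q → 0# ≤ arrival q
      location  : Request → Site

  module _ (I : Input) where
    open Input I

    Event : Set
    Event = ℝ × Component Request

    events : Schedule Request → List Event
    events = concatMap (λ A → map (time A ,_) (components A))

    maxWait : ℝ → List Request → ℝ
    maxWait t []       = 0#
    maxWait t (q ∷ qs) = foldr₁ _⊔_ (List⁺.map (λ p → t - arrival p) (q ∷ qs))

    eventCost : Event → ℝ
    eventCost (t , C) = len (walk C) + maxWait t (serves C)

    totalCost : List Event → ℝ
    totalCost = foldr (λ e c → eventCost e + c) 0#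

    cost : Schedule Request → ℝ
    cost S = totalCost (events S)

    Servable : ℝ → List Request → Walk → Request → Set
    Servable t served w q = arrival q ≤ t × q ∉ served × location q ∈ toList w

    -- Legality of the remaining events for a server now at v, when the listed
    -- requests have already been served.
    LegalFrom : Site → List Request → List Event → Set
    LegalFrom v served []            = ∀ q → q ∈ served
    LegalFrom v served ((t , C) ∷ E) =
      head (walk C) ≡ v ×
      All (Servable t served (walk C)) (serves C) ×
      LegalFrom (last (walk C)) (serves C ++ served) E

    Feasible : Schedule Request → Set
    Feasible S = Linked _≤_ (map time S) × LegalFrom s₀ [] (events S)

    Achievable : ℝ → Set
    Achievable c = ∃ λ S → Feasible S × c ≡ cost S

    achievable : ∃ Achievable
    achievable = _ , S , ([-] , refl , All.tabulate (λ {q} _ → servable q) , λ q → ∈-++⁺ˡ (∈-allFin q)) , refl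
      where
      latest : List Request → ℝ
      latest = foldr (λ q t → arrival q ⊔ t) 0#

      ≤latest : ∀ {q} qs → q ∈ qs → arrival q ≤ latest qs
      ≤latest (q ∷ qs) (here refl) = x≤x⊔y _ _
      ≤latest (q ∷ qs) (there q∈) = ≤-trans (≤latest qs q∈) (x≤y⊔x (arrival q) _)

      C : Component Request
      C = component (s₀ ∷ map location (allFin requests)) (allFin requests)

      S : Schedule Request
      S = action (latest (allFin requests)) (C ∷ []) ∷ []

      servable : ∀ q → Servable (latest (allFin requests)) [] (walk C) q
      servable q = ≤latest _ (∈-allFin q) , (λ ()) , there (∈-map⁺ location (∈-allFin q))

    0≤lenFrom : ∀ v ws → 0# ≤ lenFrom v ws
    0≤lenFrom v []       = ≤-refl
    0≤lenFrom v (w ∷ ws) = 0≤+ (0≤∣∣ _) (0≤lenFrom w ws)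

    0≤maxWait : ∀ t qs → All (λ q → arrival q ≤ t) qs → 0# ≤ maxWait t qs
    0≤maxWait t []           []         = ≤-refl
    0≤maxWait t (q ∷ [])     (q≤t ∷ []) = 0≤- q≤t
    0≤maxWait t (q ∷ p ∷ qs) (q≤t ∷ _)  = ≤-trans (0≤- q≤t) (x≤x⊔y _ _)

    0≤totalCost : ∀ v served E → LegalFrom v served E → 0# ≤ totalCost E
    0≤totalCost v served []            _                = ≤-refl
    0≤totalCost v served ((t , C) ∷ E) (_ , ok , legal) =
      0≤+ (0≤+ (0≤lenFrom _ (List⁺.tail (walk C))) (0≤maxWait t (serves C) (All.map proj₁ ok)))
          (0≤totalCost _ _ E legal)

    0≤cost : IsLowerBound Achievable 0#
    0≤cost _ (S , (_ , legal) , refl) = 0≤totalCost _ _ (events S) legal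

    optimum : ∃ (IsInfimum Achievable)
    optimum = complete Achievable achievable (0# , 0≤cost)

    OPT : ℝ
    OPT = proj₁ optimum

    open DyadicAnchorExploration R X {Request} Fin._≟_
    open State
    open Phase
    open DecMembership {A = Request} Fin._≟_ using () renaming (_∈?_ to _∈ᴿ?_)
    open DecMembership {A = Site} Fin._≟_ using () renaming (_∈?_ to _∈ˢ?_)

    revealed : ℝ → List Request → Walk → List Sighting
    revealed t served w = map (λ q → q , location q)
      (filter (λ q → (arrival q ≤? t) ×-dec ¬? (q ∈ᴿ? served) ×-dec (location q ∈ˢ? toList w))
              (allFin requests))

    arrivalTimes : List ℝ
    arrivalTimes = sort (deduplicate _≟_ (map arrival (allFin requests)))

    epoch : ℝ → List Request
    epoch t = filter (λ q → arrival q ≟ t) (allFin requests)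

    record Config : Set where
      constructor config
      field
        upcoming  : List ℝ          -- times of the epochs still to arrive
        served    : List Request
        algorithm : State

    epochStep : ℝ → List ℝ → List Request → State → Action Request × Config
    epochStep t ts served σ =
      action t (component w (identities seen) ∷ []) ,
      config ts (identities seen ++ served) (afterCheck σ t (epoch t) seen)
      where
      w    = check (anchor σ)
      seen = revealed t served w

    sweepStep : List ℝ → List Request → Site → Phase → Action Request × Config
    sweepStep ts served s φ =
      action t (component w [] ∷ proj₁ next) ,
      config ts (concatMap serves (proj₁ next) ++ served) (proj₂ next)
      where
      t    = nextSweep φ
      w    = sweep s φ
      next = afterSweep s φ (revealed t served w)

    step : Config → Maybe (Action Request × Config)
    step (config []       served (state s nothing))  = nothing
    step (config (t ∷ ts) served (state s nothing))  = just (epochStep t ts served (state s nothing))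
    step (config []       served (state s (just φ))) = just (sweepStep [] served s φ)
    step (config (t ∷ ts) served (state s (just φ))) =
      if does (t ≤? nextSweep φ)
      then just (epochStep t ts served (state s (just φ)))
      else just (sweepStep (t ∷ ts) served s φ)

    data Run : Config → Schedule Request → Set where
      halt : ∀ {c} → step c ≡ nothing → Run c []
      _∷_  : ∀ {c A c′ S} → step c ≡ just (A , c′) → Run c′ S → Run c (A ∷ S)

    -- S is the schedule the algorithm performs on I.
    Performs : Schedule Request → Set
    Performs S = Run (config arrivalTimes [] (state s₀ nothing)) S

    -- Hence "there is a run with property Q" and "the run has property Q"
    -- agree once the algorithm halts.
    run-unique : ∀ {c S S′} → Run c S → Run c S′ → S ≡ S′
    run-unique (halt _) (halt _) = refl
    run-unique (halt e) (e′ ∷ _) with () ← trans (sym e) e′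
    run-unique (e ∷ _) (halt e′) with () ← trans (sym e) e′
    run-unique (e ∷ r) (e′ ∷ r′) with refl ← trans (sym e) e′ = cong (_ ∷_) (run-unique r r′)

{-# OPTIONS --safe #-}

-- Let D be the displacement of the anchor in a phase whose last sweep has radius r.
-- Either r = δ, or a request lay undiscovered outside the previous sweep of radius
-- r / 2; so r ≤ 2 D.  The sweeps cost at most 8 r, the wait at most r and the
-- collection at most 3 D, in total at most 21 D.
--
-- Conversely Σ D ≤ 4 cost(S) for every feasible schedule S, phase by phase, with a
-- potential that depends on the position o of its server when a phase ends with
-- anchor s: −|s − o| if S has served the request that defined s, and +|s − o| if
-- that request is still pending.  While it stays pending through the next phase,
-- S accrues waiting cost equal to the length of that phase.
module Submission where

open import Defs
open import Algebra.Bundles using (CommutativeRing)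
import Algebra.Construct.NaturalChoice.Max as Max
import Algebra.Construct.NaturalChoice.Min as Min
open import Algebra.Definitions using (Selective)
import Algebra.Properties.CommutativeMonoid.Mult as Mult
import Algebra.Properties.Ring as RingProperties
import Algebra.Properties.Semiring.Mult as SemiringMult
import Algebra.Solver.CommutativeMonoid as CommutativeMonoidSolver
open import Data.Bool.Base using (if_then_else_)
open import Data.Fin.Base using (zero; suc)
import Data.Fin.Base as Fin
import Data.Fin.Properties as Fin
open import Data.List.Base
  using (List; []; _∷_; _++_; map; filter; foldr; reverse; allFin; concatMap; cartesianProduct; find;
         initLast; _∷ʳ′_)
import Data.List.Effectful as List
import Data.List.Membership.DecPropositional as DecMembership
open import Data.List.Membership.Propositional using (_∈_; _∉_)
open import Data.List.Membership.Propositional.Properties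
  using (∈-map⁺; ∈-map⁻; ∈-++⁺ˡ; ∈-++⁺ʳ; ∈-++⁻; ∈-allFin; ∈-filter⁺; ∈-filter⁻;
         ∈-cartesianProduct⁺; ∈-deduplicate⁺; ∈-deduplicate⁻)
open import Data.List.NonEmpty.Base using (List⁺; _∷_; toList; foldr₁; head; last; _⁺++_)
import Data.List.NonEmpty.Base as List⁺
import Data.List.NonEmpty.Effectful as List⁺
open import Data.List.Properties using (++-identityʳ; map-++; foldr-preservesᵇ; foldr-preservesᵒ; unfold-reverse)
open import Data.List.Relation.Binary.Permutation.Propositional using (↭⇒↭ₛ; ↭-sym)
open import Data.List.Relation.Binary.Permutation.Propositional.Properties using (∈-resp-↭)
import Data.List.Relation.Binary.Permutation.Setoid.Properties as Permutation
open import Data.List.Relation.Unary.All using (All; []; _∷_)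
import Data.List.Relation.Unary.All as All
import Data.List.Relation.Unary.All.Properties as All
open import Data.List.Relation.Unary.AllPairs using (AllPairs; []; _∷_)
import Data.List.Relation.Unary.AllPairs as AllPairs
import Data.List.Relation.Unary.AllPairs.Properties as AllPairs
open import Data.List.Relation.Unary.Any using (here; there)
import Data.List.Relation.Unary.Any as Any
import Data.List.Relation.Unary.Any.Properties as Any
open import Data.List.Relation.Unary.Linked using (Linked; [-]; _∷_)
import Data.List.Relation.Unary.Linked as Linked
open import Data.List.Relation.Unary.Linked.Properties using (Linked⇒AllPairs)
import Data.List.Relation.Unary.Unique.DecPropositional.Properties as Unique
open import Data.List.Relation.Unary.Unique.Propositional using (Unique)
import Data.List.Sort as Sort
open import Data.Maybe.Base using (Maybe; just; nothing)
import Data.Maybe.Base as Maybe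
import Data.Maybe.Effectful as Maybe
open import Data.Nat.Base using (ℕ; zero; suc)
import Data.Nat.Base as ℕ
import Data.Nat.Properties as ℕ
open import Data.Product.Base using (∃; _×_; _,_; proj₁; proj₂)
open import Data.Sum.Base using (_⊎_; inj₁; inj₂)
import Data.Sum.Base as Sum
open import Function.Base using (_∘_; flip; id)
open import Level using (0ℓ)
open import Relation.Binary.Core using (Rel)
open import Relation.Binary.Definitions using (Reflexive; Antisymmetric)
open import Relation.Binary.PropositionalEquality
  using (_≡_; _≢_; refl; sym; trans; cong; cong₂; subst; subst₂; setoid; module ≡-Reasoning)
open import Relation.Binary.Structures using (IsDecTotalOrder)
open import Relation.Nullary.Decidable
  using (Dec; does; yes; no; ¬?; _×-dec_; dec-true; dec-false; toSum)
open import Relation.Nullary.Negation using (¬_; contradiction)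

-- A displacement of the anchor need not force S to walk during that phase: S may already stand near
-- the new anchor, or it may leave the requests there pending. In the first case S stands away from
-- the old anchor, and the term |s - o| of the negative potential pays. In the second case S still
-- has to come back, which is what the positive potential records. When the old request stays
-- pending through the phase, carrying the positive potential along and paying for the displacement
-- can cost 2 D, although S may not move at all; only waiting can pay for this. The phase lasts at
-- least r, and D ≤ 2 r, so its length is at least D / 2. This fixes the factor 4 (walking alone
-- would need only 3), and 84 = 21 · 4. Waiting is charged as a maximum over the requests of a
-- service event, and one event may end waits that span many phases. The induction therefore runs on
-- costs from which all waiting before the current phase has been cut off: each phase claims only
-- the slice between its two ends, and these slices do not overlap.

module _ {A : Set} (_∙_ : A → A → A) where

  foldr₁-preserves : (P : A → Set) → (∀ {x y} → P x → P y → P (x ∙ y)) →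
                     ∀ {x xs} → All P (x ∷ xs) → P (foldr₁ _∙_ (x ∷ xs))
  foldr₁-preserves P closed (px ∷ [])       = px
  foldr₁-preserves P closed (px ∷ py ∷ pys) = closed px (foldr₁-preserves P closed (py ∷ pys))

  foldr₁-reaches : (P : A → Set) → (∀ {x} y → P x → P (x ∙ y)) → (∀ x {y} → P y → P (x ∙ y)) →
                   ∀ {x xs z} → z ∈ (x ∷ xs) → P z → P (foldr₁ _∙_ (x ∷ xs))
  foldr₁-reaches P left right {xs = []}    (here refl) pz = pz
  foldr₁-reaches P left right {xs = _ ∷ _} (here refl) pz = left _ pz
  foldr₁-reaches P left right {xs = _ ∷ _} (there z∈)  pz = right _ (foldr₁-reaches P left right z∈ pz)

-- Arithmetic in the ordered field.

module Reals (R : RealNumbers) where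
  open RealNumbers R public
  open IsDecTotalOrder isDecTotalOrder public using () renaming (antisym to ≤-antisym; reflexive to ≤-reflexive)
  open CommutativeRing commutativeRing public
    using (+-assoc; *-assoc; *-identityˡ; +-commutativeMonoid; ring; semiring)
  open RingProperties ring public using (-‿distribˡ-*; -‿involutive; ⁻¹-anti-homo‿-)
  open Max totalOrder public using (⊔-lub)
  open Min totalOrder public using (x⊓y≤x; x⊓y≤y; ⊓-glb; ⊓-sel)
  open Mult +-commutativeMonoid public using () renaming (×-assocˡ to ·-assocˡ)
  open SemiringMult semiring public using (×-assoc-*)
  open CommutativeMonoidSolver +-commutativeMonoid public
    using (Expr; _⊕_; _⊜_; solve) renaming (id to ε)

  infixr 6 _⊗_
  -- Follows the recursion of `_·_`, so that numeral multiples in a goal match solver expressions by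
  -- computation.
  _⊗_ : ∀ {n} → ℕ → Expr n → Expr n
  zero  ⊗ e = ε
  suc k ⊗ e = e ⊕ (k ⊗ e)

  infixl 6 _+≤_
  infixr 7 _·≤_

  _+≤_ : ∀ {w x y z} → w ≤ x → y ≤ z → w + y ≤ x + z
  _+≤_ {w} {x} {y} {z} w≤x y≤z =
    ≤-trans (+-monoʳ-≤ w y≤z) (subst₂ _≤_ (+-comm z w) (+-comm z x) (+-monoʳ-≤ z w≤x))

  _·≤_ : ∀ n {x y} → x ≤ y → n · x ≤ n · y
  zero  ·≤ x≤y = ≤-refl
  suc n ·≤ x≤y = x≤y +≤ n ·≤ x≤y

  x+y-y≡x : ∀ x y → x + y + (- y) ≡ x
  x+y-y≡x x y = trans (+-assoc x y (- y)) (trans (cong (x +_) (-‿inverseʳ y)) (+-identityʳ x))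

  x-y+y≡x : ∀ x y → x - y + y ≡ x
  x-y+y≡x x y = trans (+-assoc x (- y) y) (trans (cong (x +_) (-‿inverseˡ y)) (+-identityʳ x))

  +-cancelʳ-≤ : ∀ z {x y} → x + z ≤ y + z → x ≤ y
  +-cancelʳ-≤ z {x} {y} p = subst₂ _≤_ (x+y-y≡x x z) (x+y-y≡x y z) (p +≤ ≤-refl)

  -- Linear arithmetic without subtraction: l ≤ r is the sum of the hypotheses,
  -- and the equation is left to the commutative monoid solver.
  linear : ∀ {l r x y} → l ≤ r → x + r ≡ y + l → x ≤ y
  linear {r = r} {y = y} l≤r eq = +-cancelʳ-≤ r (≤-trans (≤-reflexive eq) (+-monoʳ-≤ y l≤r))

  ≰⇒≥ : ∀ {x y} → ¬ (x ≤ y) → y ≤ x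
  ≰⇒≥ {x} {y} x≰y with total x y
  ... | inj₁ x≤y = contradiction x≤y x≰y
  ... | inj₂ y≤x = y≤x

  0≤n·x : ∀ n {x} → 0# ≤ x → 0# ≤ n · x
  0≤n·x zero    0≤x = ≤-refl
  0≤n·x (suc n) 0≤x = 0≤+ 0≤x (0≤n·x n 0≤x)

  2·≡+ : ∀ x → 2 · x ≡ x + x
  2·≡+ x = cong (x +_) (+-identityʳ x)

  x≤2^n·x : ∀ n {x} → 0# ≤ x → x ≤ (2 ℕ.^ n) · x
  x≤2^n·x zero    0≤x = ≤-reflexive (sym (+-identityʳ _))
  x≤2^n·x (suc n) 0≤x = ≤-trans (x≤2^n·x n 0≤x)
    (≤-trans (linear (0≤n·x (2 ℕ.^ n) 0≤x) (solve 1 (λ a → (a ⊕ a) ⊜ ((2 ⊗ a) ⊕ ε)) refl _))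
             (≤-reflexive (·-assocˡ _ 2 (2 ℕ.^ n))))

  n·x≤2^n·x : ∀ n {x} → 0# ≤ x → n · x ≤ (2 ℕ.^ n) · x
  n·x≤2^n·x zero        0≤x = 0≤n·x 1 0≤x
  n·x≤2^n·x (suc n) {x} 0≤x =
    ≤-trans (x≤2^n·x n 0≤x +≤ n·x≤2^n·x n 0≤x)
            (≤-reflexive (trans (sym (2·≡+ _)) (·-assocˡ x 2 (2 ℕ.^ n))))

  n·-cancel-≤ : ∀ n .{{_ : ℕ.NonZero n}} {x y} → n · x ≤ n · y → x ≤ y
  n·-cancel-≤ (suc n) {x} {y} p with total x y
  ... | inj₁ x≤y = x≤y
  ... | inj₂ y≤x = +-cancelʳ-≤ (n · y) (≤-trans (+-monoʳ-≤ x (n ·≤ y≤x)) p)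

  0≤1 : 0# ≤ 1#
  0≤1 with total 0# 1#
  ... | inj₁ 0≤1 = 0≤1
  ... | inj₂ 1≤0 = subst (0# ≤_) -1*-1≡1 (*-nonneg 0≤-1 0≤-1)
    where
    0≤-1 : 0# ≤ - 1#
    0≤-1 = subst (0# ≤_) (+-identityˡ (- 1#)) (0≤- 1≤0)

    -1*-1≡1 : (- 1#) * (- 1#) ≡ 1#
    -1*-1≡1 = trans (sym (-‿distribˡ-* 1# (- 1#)))
                    (trans (cong -_ (*-identityˡ (- 1#))) (-‿involutive 1#))

  1≰0 : ¬ (1# ≤ 0#)
  1≰0 1≤0 = 0≢1 (≤-antisym 0≤1 1≤0)

  -- Division by a positive numeral: `suc n · 1#` is at least `1#`, hence nonzero and invertible.
  n·-surjective : ∀ n x → ∃ λ y → suc n · y ≡ x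
  n·-surjective n x with invertible (suc n · 1#)
                           (λ eq → 1≰0 (≤-trans (linear (0≤n·x n 0≤1) (sym (+-identityʳ _))) (≤-reflexive eq)))
  ... | y , inverse = y * x , (begin
    suc n · (y * x)            ≡⟨ cong (suc n ·_) (*-identityˡ (y * x)) ⟨
    suc n · (1# * (y * x))     ≡⟨ ×-assoc-* (suc n) 1# (y * x) ⟨
    (suc n · 1#) * (y * x)     ≡⟨ *-assoc _ y x ⟨
    (suc n · 1#) * y * x       ≡⟨ cong (_* x) inverse ⟩
    1# * x                     ≡⟨ *-identityˡ x ⟩
    x                          ∎)
    where open ≡-Reasoning

  -- `OPT` is an infimum that no schedule is known to attain, so the competitive factor has to be
  -- carried to it. Dividing `k` by the factor gives a lower bound of `A`.
  ·-infimum : ∀ n {A m k} → IsInfimum A m → (∀ c → A c → k ≤ suc n · c) → k ≤ suc n · m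
  ·-infimum n {m = m} {k} (_ , greatest) lower with n·-surjective n k
  ... | b , eq = subst (_≤ suc n · m) eq
    (suc n ·≤ greatest b (λ c Ac → n·-cancel-≤ (suc n) (subst (_≤ suc n · c) (sym eq) (lower c Ac))))

if-yes : ∀ {P A : Set} (P? : Dec P) {x y : A} → P → (if does P? then x else y) ≡ x
if-yes P? p = cong (if_then _ else _) (dec-true P? p)

if-no : ∀ {P A : Set} (P? : Dec P) {x y : A} → ¬ P → (if does P? then x else y) ≡ y
if-no P? ¬p = cong (if_then _ else _) (dec-false P? ¬p)

-- Unlike `last`, which goes through the `initLast` view, this follows the recursion of `lenFrom`,
-- so that walks can be treated by induction.
lastFrom : {A : Set} → A → List A → A
lastFrom x []       = x
lastFrom x (y ∷ ys) = lastFrom y ys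

last-∷ : ∀ {A : Set} (x : A) xs → last (x ∷ xs) ≡ lastFrom x xs
last-∷ x []       = refl
last-∷ x (y ∷ ys) = trans (last-∷∷ x y ys) (last-∷ y ys)
  where
  last-∷∷ : ∀ {A : Set} (x y : A) ys → last (x ∷ y ∷ ys) ≡ last (y ∷ ys)
  last-∷∷ x y ys with initLast ys
  ... | []       = refl
  ... | _ ∷ʳ′ _ = refl

lastFrom-++ : ∀ {A : Set} (x : A) xs ys → lastFrom x (xs ++ ys) ≡ lastFrom (lastFrom x xs) ys
lastFrom-++ x []       ys = refl
lastFrom-++ x (y ∷ xs) ys = lastFrom-++ y xs ys

lastFrom-∈ : ∀ {A : Set} (x : A) xs → lastFrom x xs ∈ (x ∷ xs)
lastFrom-∈ x []       = here refl
lastFrom-∈ x (y ∷ ys) = there (lastFrom-∈ y ys)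

reverse⁺ : ∀ {A : Set} {_~_ : Rel A 0ℓ} {xs} → AllPairs _~_ xs → AllPairs (flip _~_) (reverse xs)
reverse⁺                  []              = []
reverse⁺ {xs = x ∷ xs} (x~ ∷ pairs) rewrite unfold-reverse x xs =
  AllPairs.++⁺ (reverse⁺ pairs) ([] ∷ [])
    (All.tabulate (λ y∈ → All.lookup x~ (Any.reverse⁻ y∈) ∷ []))

-- Identifies the end of a monotone move: the site aimed at belongs to the ordered list and bounds
-- it.
lastFrom-max : ∀ {A : Set} {_~_ : Rel A 0ℓ} → Reflexive _~_ → Antisymmetric _≡_ _~_ →
               ∀ {x xs y} → AllPairs _~_ (x ∷ xs) → y ∈ (x ∷ xs) → All (_~ y) (x ∷ xs) →
               lastFrom x xs ≡ y
lastFrom-max refl~ antisym {x} {xs} (x~ ∷ _) (here refl) below =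
  antisym (All.lookup below (lastFrom-∈ x xs)) (All.lookup (refl~ ∷ x~) (lastFrom-∈ x xs))
lastFrom-max refl~ antisym {xs = _ ∷ _} (_ ∷ pairs) (there y∈) (_ ∷ below) =
  lastFrom-max refl~ antisym pairs y∈ below

selective-closed : ∀ {A : Set} {_∙_ : A → A → A} → Selective _≡_ _∙_ →
                   ∀ (P : A → Set) {x y} → P x → P y → P (x ∙ y)
selective-closed sel P {x} {y} px py with sel x y
... | inj₁ eq = subst P (sym eq) px
... | inj₂ eq = subst P (sym eq) py

-- Distances, monotone moves, sweeps and collecting walks on the line.

module Geometry (R : RealNumbers) (X : FiniteSubset R) where
  open Reals R
  open Line R X public
  open Min (Fin.≤-totalOrder (suc (suc size-2))) using ()
    renaming (x⊓y≤x to leftmost≤ˡ; x⊓y≤y to leftmost≤ʳ; ⊓-sel to leftmost-sel)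
  open Max (Fin.≤-totalOrder (suc (suc size-2))) using ()
    renaming (x≤x⊔y to ≤rightmostˡ; x≤y⊔x to ≤rightmostʳ; ⊔-sel to rightmost-sel)

  coord-mono : ∀ {x y} → x Fin.≤ y → coord x ≤ coord y
  coord-mono {x} {y} x≤y with x Fin.≟ y
  ... | yes refl = ≤-refl
  ... | no  x≢y  = proj₁ (increasing (Fin.≤∧≢⇒< x≤y x≢y))

  coord-cancel : ∀ {x y} → coord x ≤ coord y → x Fin.≤ y
  coord-cancel {x} {y} p with x Fin.≤? y
  ... | yes x≤y = x≤y
  ... | no  x≰y = let y≤x , y≢x = increasing (ℕ.≰⇒> x≰y) in contradiction (≤-antisym y≤x p) y≢x

  coord-injective : ∀ {x y} → coord x ≡ coord y → x ≡ y
  coord-injective eq =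
    Fin.≤-antisym (coord-cancel (≤-reflexive eq)) (coord-cancel (≤-reflexive (sym eq)))

  dist-sym : ∀ x y → dist x y ≡ dist y x
  dist≤ : ∀ {x y d} → coord x ≤ coord y + d → coord y ≤ coord x + d → dist x y ≤ d
  coord≤ : ∀ x y → coord x ≤ coord y + dist x y

  dist≤ {x} {y} {d} p q =
    ⊔-lub (difference p) (subst (_≤ d) (sym (⁻¹-anti-homo‿- _ _)) (difference q))
    where
    difference : ∀ {a b} → a ≤ b + d → a - b ≤ d
    difference {a} {b} p =
      +-cancelʳ-≤ b (subst₂ _≤_ (sym (x-y+y≡x a b)) (+-comm b d) p)

  coord≤ x y = subst (_≤ coord y + dist x y)
    (trans (+-comm (coord y) _) (x-y+y≡x (coord x) (coord y)))
    (+-monoʳ-≤ (coord y) (x≤x⊔y _ _))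

  dist-sym x y = ≤-antisym (half x y) (half y x)
    where
    half : ∀ x y → dist x y ≤ dist y x
    half x y = dist≤ (subst (_≤ coord y + dist y x)
        (trans (cong (coord y +_) (⁻¹-anti-homo‿- (coord y) (coord x)))
               (trans (+-comm (coord y) _) (x-y+y≡x (coord x) (coord y))))
        (+-monoʳ-≤ (coord y) (x≤y⊔x (coord y - coord x) _)))
      (coord≤ y x)

  coord≤′ : ∀ x y → coord y ≤ coord x + dist x y
  coord≤′ x y = subst (λ d → coord y ≤ coord x + d) (dist-sym y x) (coord≤ y x)

  0≤dist : ∀ x y → 0# ≤ dist x y
  0≤dist x y = 0≤∣∣ _

  dist-refl : ∀ x → dist x x ≡ 0#
  dist-refl x = ≤-antisym (dist≤ (≤-reflexive (sym (+-identityʳ _))) (≤-reflexive (sym (+-identityʳ _))))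
                          (0≤dist x x)

  dist-triangle : ∀ x y z → dist x z ≤ dist x y + dist y z
  dist-triangle x y z = dist≤
    (linear (coord≤ x y +≤ coord≤ y z)
      (solve 5 (λ a b c d e → (a ⊕ ((b ⊕ d) ⊕ (c ⊕ e))) ⊜ ((c ⊕ (d ⊕ e)) ⊕ (a ⊕ b))) refl
        (coord x) (coord y) (coord z) _ _))
    (linear (coord≤′ x y +≤ coord≤′ y z)
      (solve 5 (λ a b c d e → (c ⊕ ((a ⊕ d) ⊕ (b ⊕ e))) ⊜ ((a ⊕ (d ⊕ e)) ⊕ (b ⊕ c))) refl
        (coord x) (coord y) (coord z) _ _))

  dist≤-between : ∀ {x a b z d} → a Fin.≤ z → z Fin.≤ b → dist x a ≤ d → dist x b ≤ d → dist x z ≤ d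
  dist≤-between {x} {a} {b} a≤z z≤b xa xb = dist≤
    (≤-trans (coord≤ x a) (coord-mono a≤z +≤ xa))
    (≤-trans (coord-mono z≤b) (≤-trans (coord≤′ x b) (+-monoʳ-≤ _ xb)))

  dist-additive : ∀ {x y z} → x Fin.≤ y → y Fin.≤ z → dist x y + dist y z ≤ dist x z
  dist-additive {x} {y} {z} x≤y y≤z =
    linear (ascending x≤y +≤ ascending y≤z +≤ coord≤′ x z)
      (solve 6 (λ a b c d e f →
          ((d ⊕ e) ⊕ ((b ⊕ c) ⊕ (a ⊕ f))) ⊜ (f ⊕ (((a ⊕ d) ⊕ (b ⊕ e)) ⊕ c))) refl
        (coord x) (coord y) (coord z) _ _ _)
    where
    ascending : ∀ {x y} → x Fin.≤ y → coord x + dist x y ≤ coord y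
    ascending {x} {y} x≤y =
      subst (_≤ coord y) (+-comm _ (coord x)) (subst (dist x y + coord x ≤_) (x-y+y≡x (coord y) (coord x))
        (dist≤ (≤-trans (coord-mono x≤y) (≤-trans (≤-reflexive (sym (+-identityʳ _))) (+-monoʳ-≤ _ (0≤- (coord-mono x≤y)))))
               (≤-reflexive (trans (sym (x-y+y≡x (coord y) (coord x))) (+-comm _ (coord x))))
         +≤ ≤-refl))

  dist-additive′ : ∀ {x y z} → y Fin.≤ x → z Fin.≤ y → dist x y + dist y z ≤ dist x z
  dist-additive′ {x} {y} {z} y≤x z≤y =
    subst₂ _≤_ (trans (cong₂ _+_ (dist-sym z y) (dist-sym y x)) (+-comm _ _)) (dist-sym z x)
      (dist-additive z≤y y≤x)

  lenFrom-++ : ∀ x xs ys → lenFrom x (xs ++ ys) ≡ lenFrom x xs + lenFrom (lastFrom x xs) ys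
  lenFrom-++ x []       ys = sym (+-identityˡ _)
  lenFrom-++ x (y ∷ xs) ys = trans (cong (dist x y +_) (lenFrom-++ y xs ys)) (sym (+-assoc _ _ _))

  dist≤lenFrom : ∀ x xs → dist x (lastFrom x xs) ≤ lenFrom x xs
  dist≤lenFrom x []       = ≤-reflexive (dist-refl x)
  dist≤lenFrom x (y ∷ xs) = ≤-trans (dist-triangle x y _) (+-monoʳ-≤ _ (dist≤lenFrom y xs))

  detour≤lenFrom : ∀ x xs {z} → z ∈ (x ∷ xs) → dist x z + dist z (lastFrom x xs) ≤ lenFrom x xs
  detour≤lenFrom x xs (here refl) =
    ≤-trans (≤-reflexive (trans (cong (_+ dist x (lastFrom x xs)) (dist-refl x)) (+-identityˡ _))) (dist≤lenFrom x xs)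
  detour≤lenFrom x (y ∷ xs) {z} (there z∈) =
    ≤-trans (linear (dist-triangle x y z)
              (solve 4 (λ a b c d → ((a ⊕ b) ⊕ (c ⊕ d)) ⊜ ((c ⊕ (d ⊕ b)) ⊕ a)) refl _ _ _ _))
            (+-monoʳ-≤ (dist x y) (detour≤lenFrom y xs z∈))

  -- Additivity telescopes along the list. The relation is a parameter so that rightward and
  -- leftward moves share one argument.
  straight : ∀ {_~_ : Rel Site 0ℓ} → (∀ {x y z} → x ~ y → y ~ z → dist x y + dist y z ≤ dist x z) →
             Reflexive _~_ → ∀ {x xs} → AllPairs _~_ (x ∷ xs) → lenFrom x xs ≤ dist x (lastFrom x xs)
  straight additive refl~ {x} {[]}     _ = 0≤dist x x
  straight additive refl~ {x} {y ∷ xs} ((x~y ∷ _) ∷ pairs@(y~ ∷ _)) =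
    ≤-trans (+-monoʳ-≤ _ (straight additive refl~ pairs))
            (additive x~y (All.lookup (refl~ ∷ y~) (lastFrom-∈ y xs)))

  sites-ascending : AllPairs Fin._≤_ sites
  sites-ascending = AllPairs.tabulate⁺-< ℕ.<⇒≤

  record MonotoneMove (x y : Site) (zs : List Site) : Set where
    field
      ends   : lastFrom x zs ≡ y
      length : lenFrom x zs ≤ dist x y
      covers : ∀ {z} → x Fin.≤ z × z Fin.≤ y ⊎ y Fin.≤ z × z Fin.≤ x → z ∈ (x ∷ zs)

  move-monotone : ∀ x y → MonotoneMove x y (move x y)
  move-monotone x y with x Fin.≤? y
  ... | yes x≤y = subst (MonotoneMove x y) (sym (if-yes (x Fin.≤? y) x≤y)) record
    { ends   = ends
    ; length = subst (λ e → lenFrom x (filter P? sites) ≤ dist x e) ends (straight dist-additive Fin.≤-refl pairs)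
    ; covers = Sum.[ covers , (λ (y≤z , z≤x) → covers (Fin.≤-trans x≤y y≤z , Fin.≤-trans z≤x x≤y)) ]
    }
    where
    P? : ∀ z → Dec _
    P? = λ z → (x Fin.<? z) ×-dec (z Fin.≤? y)
    bounds : All (λ z → x Fin.< z × z Fin.≤ y) (filter P? sites)
    bounds = All.all-filter P? sites
    pairs : AllPairs Fin._≤_ (x ∷ filter P? sites)
    pairs = All.map (ℕ.<⇒≤ ∘ proj₁) bounds ∷ AllPairs.filter⁺ P? sites-ascending
    covers : ∀ {z} → x Fin.≤ z × z Fin.≤ y → z ∈ (x ∷ filter P? sites)
    covers {z} (x≤z , z≤y) with x Fin.≟ z
    ... | yes refl = here refl
    ... | no  x≢z  = there (∈-filter⁺ P? (∈-allFin z) (Fin.≤∧≢⇒< x≤z x≢z , z≤y))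
    ends : lastFrom x (filter P? sites) ≡ y
    ends = lastFrom-max Fin.≤-refl Fin.≤-antisym pairs (covers (x≤y , Fin.≤-refl)) (x≤y ∷ All.map proj₂ bounds)
  ... | no  x≰y = subst (MonotoneMove x y) (sym (if-no (x Fin.≤? y) x≰y)) record
    { ends   = ends
    ; length = subst (λ e → lenFrom x (reverse (filter P? sites)) ≤ dist x e) ends (straight dist-additive′ Fin.≤-refl pairs)
    ; covers = Sum.[ (λ (x≤z , z≤y) → contradiction (Fin.≤-trans x≤z z≤y) x≰y) , covers ]
    }
    where
    y≤x = ℕ.<⇒≤ (ℕ.≰⇒> x≰y)
    P? : ∀ z → Dec _
    P? = λ z → (y Fin.≤? z) ×-dec (z Fin.<? x)
    bounds : All (λ z → y Fin.≤ z × z Fin.< x) (reverse (filter P? sites))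
    bounds = All.tabulate (λ z∈ → All.lookup (All.all-filter P? sites) (Any.reverse⁻ z∈))
    pairs : AllPairs (flip Fin._≤_) (x ∷ reverse (filter P? sites))
    pairs = All.map (ℕ.<⇒≤ ∘ proj₂) bounds ∷ reverse⁺ (AllPairs.filter⁺ P? sites-ascending)
    covers : ∀ {z} → y Fin.≤ z × z Fin.≤ x → z ∈ (x ∷ reverse (filter P? sites))
    covers {z} (y≤z , z≤x) with z Fin.≟ x
    ... | yes refl = here refl
    ... | no  z≢x  = there (Any.reverse⁺ (∈-filter⁺ P? (∈-allFin z) (y≤z , Fin.≤∧≢⇒< z≤x z≢x)))
    ends : lastFrom x (reverse (filter P? sites)) ≡ y
    ends = lastFrom-max Fin.≤-refl (flip Fin.≤-antisym) pairs (covers (Fin.≤-refl , y≤x)) (y≤x ∷ All.map proj₁ bounds)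

  lastFrom-moves : ∀ x ys → lastFrom x (moves x ys) ≡ lastFrom x ys
  lastFrom-moves x []       = refl
  lastFrom-moves x (y ∷ ys) = begin
    lastFrom x (move x y ++ moves y ys)            ≡⟨ lastFrom-++ x (move x y) _ ⟩
    lastFrom (lastFrom x (move x y)) (moves y ys)  ≡⟨ cong (λ e → lastFrom e (moves y ys)) (MonotoneMove.ends (move-monotone x y)) ⟩
    lastFrom y (moves y ys)                        ≡⟨ lastFrom-moves y ys ⟩
    lastFrom y ys                                  ∎
    where open ≡-Reasoning

  lenFrom-moves : ∀ x ys → lenFrom x (moves x ys) ≤ lenFrom x ys
  lenFrom-moves x []       = ≤-refl
  lenFrom-moves x (y ∷ ys) = ≤-trans
    (≤-reflexive (trans (lenFrom-++ x (move x y) _)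
      (cong (λ e → lenFrom x (move x y) + lenFrom e (moves y ys)) (MonotoneMove.ends (move-monotone x y)))))
    (MonotoneMove.length (move-monotone x y) +≤ lenFrom-moves y ys)

  last-route : ∀ x ys → last (route x ys) ≡ lastFrom x ys
  last-route x ys = trans (last-∷ x (moves x ys)) (lastFrom-moves x ys)

  covered-now : ∀ {x y ys z} → x Fin.≤ z × z Fin.≤ y ⊎ y Fin.≤ z × z Fin.≤ x →
                z ∈ toList (route x (y ∷ ys))
  covered-now {x} {y} between = ∈-++⁺ˡ (MonotoneMove.covers (move-monotone x y) between)

  covered-later : ∀ {x y ys z} → z ∈ toList (route y ys) → z ∈ toList (route x (y ∷ ys))
  covered-later {x} {y} {ys} (here refl) with Fin.≤-total x y
  ... | inj₁ x≤y = covered-now {ys = ys} (inj₁ (x≤y , Fin.≤-refl))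
  ... | inj₂ y≤x = covered-now {ys = ys} (inj₂ (Fin.≤-refl , y≤x))
  covered-later {x} {y} (there z∈) = there (∈-++⁺ʳ (move x y) z∈)

  dist-positive : ∀ {x y} → x ≢ y → ¬ (dist x y ≤ 0#)
  dist-positive {x} {y} x≢y d≤0 = x≢y (coord-injective (≤-antisym (below (coord≤ x y)) (below (coord≤′ x y))))
    where
    below : ∀ {a b} → a ≤ b + dist x y → a ≤ b
    below p = ≤-trans p (≤-trans (+-monoʳ-≤ _ d≤0) (≤-reflexive (+-identityʳ _)))

  dist₂ : Site × Site → ℝ
  dist₂ (x , y) = dist x y

  distinct? : (p : Site × Site) → Dec (proj₁ p ≢ proj₂ p)
  distinct? (x , y) = ¬? (x Fin.≟ y)

  distances : List ℝ
  distances = map dist₂ (filter distinct? (cartesianProduct sites sites))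

  δ-positive : ¬ (δ ≤ 0#)
  δ-positive = foldr-preservesᵇ {P = λ d → ¬ (d ≤ 0#)} (selective-closed ⊓-sel (λ d → ¬ (d ≤ 0#))) {xs = distances}
    (dist-positive {zero} {suc zero} (λ ()))
    (All.map⁺ (All.map dist-positive (All.all-filter distinct? (cartesianProduct sites sites))))

  0≤δ : 0# ≤ δ
  0≤δ = ≰⇒≥ δ-positive

  δ≤dist : ∀ {x y} → x ≢ y → δ ≤ dist x y
  δ≤dist {x} {y} x≢y = foldr-preservesᵒ {P = _≤ dist x y}
    (λ a b → Sum.[ ≤-trans (x⊓y≤x a b) , ≤-trans (x⊓y≤y a b) ])
    (dist zero (suc zero)) distances (inj₂ (Any.map (λ eq → ≤-reflexive (sym eq)) (∈-map⁺ dist₂ pair∈)))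
    where
    pair∈ : (x , y) ∈ filter distinct? (cartesianProduct sites sites)
    pair∈ = ∈-filter⁺ distinct? (∈-cartesianProduct⁺ (∈-allFin x) (∈-allFin y)) x≢y

  0≤radius : ∀ n → 0# ≤ radius n
  0≤radius n = 0≤n·x (2 ℕ.^ n) 0≤δ

  radius-suc : ∀ n → radius (suc n) ≡ 2 · radius n
  radius-suc n = sym (·-assocˡ δ 2 (2 ℕ.^ n))

  Covering : ℕ → Set
  Covering n = ∀ x y → dist x y ≤ radius n

  -- The Archimedean property bounds the diameter by a multiple n of `δ`, and n ≤ 2^n. A sweep of
  -- this index misses no site, which bounds the number of sweeps in a phase.
  covering : ∃ Covering
  covering with archimedean (dist zero (Fin.fromℕ _)) δ-positive
  ... | n , diameter≤ = n , λ x y → ≤-trans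
    (dist≤ (to-diameter x y) (to-diameter y x)) (≤-trans diameter≤ (n·x≤2^n·x n 0≤δ))
    where
    to-diameter : ∀ x y → coord x ≤ coord y + dist zero (Fin.fromℕ _)
    to-diameter x y = ≤-trans (coord-mono (Fin.≤fromℕ x))
      (≤-trans (coord≤′ zero _) (coord-mono {zero} {y} ℕ.z≤n +≤ ≤-refl))

  within? : ∀ s r z → Dec (coord s - r ≤ coord z × coord z ≤ coord s + r)
  within? s r z = (coord s - r ≤? coord z) ×-dec (coord z ≤? coord s + r)

  module Window (s : Site) {r : ℝ} (0≤r : 0# ≤ r) where

    -- Membership in the window with the subtraction moved across, the form that `dist≤` consumes.
    Near : Site → Set
    Near z = coord s ≤ coord z + r × coord z ≤ coord s + r

    near : ∀ {z} → coord s - r ≤ coord z × coord z ≤ coord s + r → Near z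
    near (s-r≤z , z≤s+r) = subst (_≤ coord _ + r) (x-y+y≡x (coord s) r) (s-r≤z +≤ ≤-refl) , z≤s+r

    near-centre : Near s
    near-centre = ≤+ , ≤+
      where
      ≤+ : coord s ≤ coord s + r
      ≤+ = ≤-trans (≤-reflexive (sym (+-identityʳ _))) (+-monoʳ-≤ _ 0≤r)

    all-near : All Near (within s r)
    all-near = All.map near (All.all-filter (within? s r) sites)

    dist-leftEnd : dist s (leftEnd s r) ≤ r
    dist-leftEnd = let p , q = foldr-preservesᵇ {P = Near} (selective-closed leftmost-sel Near) near-centre all-near in dist≤ p q

    dist-rightEnd : dist s (rightEnd s r) ≤ r
    dist-rightEnd = let p , q = foldr-preservesᵇ {P = Near} (selective-closed rightmost-sel Near) near-centre all-near in dist≤ p q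

    ∈-within : ∀ {z} → dist s z ≤ r → z ∈ within s r
    ∈-within {z} d≤r = ∈-filter⁺ (within? s r) (∈-allFin z)
      ( +-cancelʳ-≤ r (≤-trans (≤-reflexive (x-y+y≡x (coord s) r))
                        (≤-trans (coord≤ s z) (+-monoʳ-≤ _ d≤r)))
      , ≤-trans (coord≤′ s z) (+-monoʳ-≤ _ d≤r) )

    leftEnd≤ : ∀ {z} → dist s z ≤ r → leftEnd s r Fin.≤ z
    leftEnd≤ {z} d≤r = foldr-preservesᵒ {P = Fin._≤ z}
      (λ x y → Sum.[ Fin.≤-trans (leftmost≤ˡ x y) , Fin.≤-trans (leftmost≤ʳ x y) ])
      s (within s r) (inj₂ (Any.map (λ eq → Fin.≤-reflexive (sym eq)) (∈-within d≤r)))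

    ≤rightEnd : ∀ {z} → dist s z ≤ r → z Fin.≤ rightEnd s r
    ≤rightEnd {z} d≤r = foldr-preservesᵒ {P = z Fin.≤_}
      (λ x y → Sum.[ (λ z≤x → Fin.≤-trans z≤x (≤rightmostˡ x y)) , (λ z≤y → Fin.≤-trans z≤y (≤rightmostʳ x y)) ])
      s (within s r) (inj₂ (Any.map Fin.≤-reflexive (∈-within d≤r)))

    tour : Walk
    tour = route s (leftEnd s r ∷ rightEnd s r ∷ s ∷ [])

    tour-covers : ∀ {z} → dist s z ≤ r → z ∈ toList tour
    tour-covers d≤r = covered-later {ys = rightEnd s r ∷ s ∷ []} (covered-now {ys = s ∷ []} (inj₁ (leftEnd≤ d≤r , ≤rightEnd d≤r)))

    len-tour : len tour ≤ 4 · r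
    len-tour = ≤-trans (lenFrom-moves s (leftEnd s r ∷ rightEnd s r ∷ s ∷ []))
      -- The outer legs cost at most r each, and the middle leg at most 2 r by comparison with a
      -- path through s.
      (linear (dist-triangle (leftEnd s r) s (rightEnd s r) +≤ ≤-reflexive (dist-sym (leftEnd s r) s)
               +≤ ≤-reflexive (dist-sym (rightEnd s r) s) +≤ 2 ·≤ dist-rightEnd +≤ 2 ·≤ dist-leftEnd)
        (solve 6 (λ a b c e f r →
            ((a ⊕ (b ⊕ (c ⊕ ε))) ⊕ ((((e ⊕ f) ⊕ a) ⊕ f) ⊕ 2 ⊗ r) ⊕ 2 ⊗ r)
              ⊜ (4 ⊗ r ⊕ (((b ⊕ e) ⊕ c) ⊕ 2 ⊗ f) ⊕ 2 ⊗ a)) refl _ _ _ _ _ _))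

    last-tour : last tour ≡ s
    last-tour = last-route s (leftEnd s r ∷ rightEnd s r ∷ s ∷ [])

    -- A closed walk through `z` is at least twice as long as the distance to `z`. This is the
    -- source of D ≤ 2 r.
    tour-visits-near : ∀ {z} → z ∈ toList tour → 2 · dist s z ≤ 4 · r
    tour-visits-near {z} z∈ = ≤-trans
      (linear (detour≤lenFrom s _ z∈ +≤ ≤-reflexive
          (trans (dist-sym s z) (sym (cong (dist z) (lastFrom-moves s (leftEnd s r ∷ rightEnd s r ∷ s ∷ []))))))
        (solve 3 (λ a b c → (2 ⊗ a ⊕ (c ⊕ b)) ⊜ (c ⊕ ((a ⊕ b) ⊕ a))) refl _ _ _))
      len-tour

  record Collects (s : Site) (ls : List Site) (w : Walk) (s′ : Site) : Set where
    field
      begins   : head w ≡ s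
      ends     : last w ≡ s′
      target   : s′ ∈ ls
      farthest : ∀ {z} → z ∈ ls → dist s z ≤ dist s s′
      covers   : ∀ {z} → z ∈ ls → z ∈ toList w
      short    : len w ≤ 3 · dist s s′

  -- Visiting the nearer end first gives |sa| + |ab| ≤ 2 |sa| + |sb| ≤ 3 |sb|. The disjunction
  -- leaves the orientation open, so both branches of `collect` are instances.
  near-then-far : ∀ {s ls a b} → b ∈ ls →
    (∀ {z} → z ∈ ls → a Fin.≤ z × z Fin.≤ b ⊎ b Fin.≤ z × z Fin.≤ a) →
    dist s a ≤ dist s b → Collects s ls (route s (a ∷ b ∷ [])) b
  near-then-far {s} {a = a} {b} b∈ between a≤b = record
    { begins   = refl
    ; ends     = last-route s (a ∷ b ∷ [])
    ; target   = b∈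
    ; farthest = λ z∈ → Sum.[ (λ (a≤z , z≤b) → dist≤-between a≤z z≤b a≤b ≤-refl)
                            , (λ (b≤z , z≤a) → dist≤-between b≤z z≤a ≤-refl a≤b) ] (between z∈)
    ; covers   = λ z∈ → covered-later {ys = b ∷ []} (covered-now {ys = []} (between z∈))
    ; short    = ≤-trans (lenFrom-moves s (a ∷ b ∷ []))
        (linear (dist-triangle a s b +≤ ≤-reflexive (dist-sym a s) +≤ 2 ·≤ a≤b)
          (solve 4 (λ sa ab as sb → ((sa ⊕ (ab ⊕ ε)) ⊕ (((as ⊕ sb) ⊕ sa) ⊕ 2 ⊗ sb))
                                  ⊜ (3 ⊗ sb ⊕ ((ab ⊕ as) ⊕ 2 ⊗ sa))) refl _ _ _ _))
    }

  module _ (ls : List⁺ Site) where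

    leftmost∈ : foldr₁ leftmost ls ∈ toList ls
    leftmost∈ = foldr₁-preserves leftmost (_∈ toList ls) 
      (selective-closed leftmost-sel (_∈ toList ls)) (All.tabulate (λ z∈ → z∈))

    rightmost∈ : foldr₁ rightmost ls ∈ toList ls
    rightmost∈ = foldr₁-preserves rightmost (_∈ toList ls) 
      (selective-closed rightmost-sel (_∈ toList ls)) (All.tabulate (λ z∈ → z∈))

    leftmost≤ : ∀ {z} → z ∈ toList ls → foldr₁ leftmost ls Fin.≤ z
    leftmost≤ {z} z∈ = foldr₁-reaches leftmost (Fin._≤ z)
      (λ y → Fin.≤-trans (leftmost≤ˡ _ y)) (λ x → Fin.≤-trans (leftmost≤ʳ x _)) z∈ Fin.≤-refl

    ≤rightmost : ∀ {z} → z ∈ toList ls → z Fin.≤ foldr₁ rightmost ls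
    ≤rightmost {z} z∈ = foldr₁-reaches rightmost (z Fin.≤_)
      (λ y z≤x → Fin.≤-trans z≤x (≤rightmostˡ _ y)) (λ x z≤y → Fin.≤-trans z≤y (≤rightmostʳ x _))
      z∈ Fin.≤-refl

-- Charging anchor displacement to an arbitrary feasible schedule.

module LowerBound (R : RealNumbers) (X : FiniteSubset R) (s₀ : Line.Site R X)
                  (I : BlindElectiveService.Input R X s₀) where
  open Reals R
  open Geometry R X
  private module Service = BlindElectiveService R X s₀
  open Service using (0≤maxWait)
  open Service.Input I
  open Component
  open DecMembership {A = Request} Fin._≟_ using (_∈?_)

  Event : Set
  Event = Service.Event I

  maxWait : ℝ → List Request → ℝ
  maxWait = Service.maxWait I

  LegalFrom : Site → List Request → List Event → Set
  LegalFrom = Service.LegalFrom I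

  totalCost : List Event → ℝ
  totalCost = Service.totalCost I

  -- A sequence of phases from anchor s, the first beginning after time τ, with total
  -- anchor displacement Δ; q is a request at the next anchor, β the phase's end.  Twice
  -- the distance is bounded because q was seen on a closed sweep from s, of length at
  -- most 4 r ≤ 4 (β − τ).
  data Chain : Site → ℝ → ℝ → Set where
    done  : ∀ {s τ} → Chain s τ 0#
    phase : ∀ {s τ Δ} q β → ¬ (arrival q ≤ τ) → arrival q ≤ β →
            2 · dist s (location q) + 4 · τ ≤ 4 · β →
            Chain (location q) β Δ → Chain s τ (dist s (location q) + Δ)

  chain-weaken : ∀ {s τ τ′ Δ} → τ′ ≤ τ → Chain s τ Δ → Chain s τ′ Δ
  chain-weaken τ′≤τ done = done
  chain-weaken τ′≤τ (phase q β late early long chain) =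
    phase q β (λ a≤τ′ → late (≤-trans a≤τ′ τ′≤τ)) early
      (≤-trans (+-monoʳ-≤ _ (4 ·≤ τ′≤τ)) long) chain

  t-arrival≤maxWait : ∀ t {q qs} → q ∈ qs → t - arrival q ≤ maxWait t qs
  t-arrival≤maxWait t {q} {qs@(_ ∷ _)} q∈ =
    foldr₁-reaches _⊔_ (t - arrival q ≤_)
      (λ y p → ≤-trans p (x≤x⊔y _ y)) (λ x p → ≤-trans p (x≤y⊔x x _))
      (∈-map⁺ (λ p → t - arrival p) q∈) ≤-refl

  -- An event's waiting cost, without the part accrued before time τ.
  waitAfter : ℝ → Event → ℝ
  waitAfter τ (t , C) = maxWait t (serves C) ⊓ (t - τ)

  costAfter : ℝ → List Event → ℝ
  costAfter τ = foldr (λ e c → (len (walk (proj₂ e)) + waitAfter τ e) + c) 0#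

  walked : List Event → ℝ
  walked = foldr (λ e c → len (walk (proj₂ e)) + c) 0#

  positionAfter : Site → List Event → Site
  positionAfter o []            = o
  positionAfter o ((t , C) ∷ E) = positionAfter (last (walk C)) E

  servedAfter : List Request → List Event → List Request
  servedAfter served []            = served
  servedAfter served ((t , C) ∷ E) = servedAfter (serves C ++ served) E

  costAfter≤totalCost : ∀ τ E → costAfter τ E ≤ totalCost E
  costAfter≤totalCost τ []            = ≤-refl
  costAfter≤totalCost τ ((t , C) ∷ E) = +-monoʳ-≤ _ (x⊓y≤x _ _) +≤ costAfter≤totalCost τ E

  costAfter-++ : ∀ τ A B → costAfter τ (A ++ B) ≡ costAfter τ A + costAfter τ B
  costAfter-++ τ []      B = sym (+-identityˡ _)
  costAfter-++ τ (e ∷ A) B = trans (cong (_ +_) (costAfter-++ τ A B)) (sym (+-assoc _ _ _))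

  legal-++ʳ : ∀ {o served} A {B} → LegalFrom o served (A ++ B) →
              LegalFrom (positionAfter o A) (servedAfter served A) B
  legal-++ʳ []      legal           = legal
  legal-++ʳ (_ ∷ A) (_ , _ , legal) = legal-++ʳ A legal

  0≤walked : ∀ A → 0# ≤ walked A
  0≤walked []                  = ≤-refl
  0≤walked ((t , component (v ∷ vs) _) ∷ A) = 0≤+ (≤-trans (0≤dist v _) (dist≤lenFrom v vs)) (0≤walked A)

  walked≤costAfter : ∀ {τ o served} A {B} → LegalFrom o served (A ++ B) →
                     All (λ e → τ ≤ proj₁ e) A → walked A ≤ costAfter τ A
  walked≤costAfter []            _                []             = ≤-refl
  walked≤costAfter {τ} ((t , C) ∷ A) (_ , ok , legal) (τ≤t ∷ later) =
    ≤-trans (≤-reflexive (sym (+-identityʳ _))) (+-monoʳ-≤ _ (⊓-glb (0≤maxWait I t _ (All.map proj₁ ok)) (0≤- τ≤t)))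
      +≤ walked≤costAfter A legal later

  displacement≤walked : ∀ {o served} A {B} → LegalFrom o served (A ++ B) →
                        dist o (positionAfter o A) ≤ walked A
  displacement≤walked {o} [] _ = ≤-reflexive (dist-refl o)
  displacement≤walked ((t , component (v ∷ vs) _) ∷ A) (refl , _ , legal) =
    ≤-trans (dist-triangle v (last (v ∷ vs)) _)
      (subst (λ e → dist v e ≤ lenFrom v vs) (sym (last-∷ v vs)) (dist≤lenFrom v vs)
        +≤ displacement≤walked A legal)

  detour≤walked : ∀ {o served q} A {B} → LegalFrom o served (A ++ B) →
                  q ∈ servedAfter served A → q ∉ served →
                  dist o (location q) + dist (location q) (positionAfter o A) ≤ walked A
  detour≤walked [] _ q∈ q∉ = contradiction q∈ q∉
  detour≤walked {served = served} {q} ((t , component (v ∷ vs) qs) ∷ A) (refl , ok , legal) q∈ q∉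
    with q ∈? qs
  ... | yes q∈qs = ≤-trans
    (linear (dist-triangle (location q) (last (v ∷ vs)) (positionAfter (last (v ∷ vs)) A))
      (solve 4 (λ a b c d → ((a ⊕ b) ⊕ (c ⊕ d)) ⊜ (((a ⊕ c) ⊕ d) ⊕ b)) refl _ _ _ _))
    (subst (λ e → dist v (location q) + dist (location q) e ≤ lenFrom v vs) (sym (last-∷ v vs))
        (detour≤lenFrom v vs (proj₂ (proj₂ (All.lookup ok q∈qs))))
      +≤ displacement≤walked A legal)
  ... | no  q∉qs = ≤-trans
    (linear (dist-triangle v (last (v ∷ vs)) (location q))
      (solve 4 (λ a b c d → ((a ⊕ b) ⊕ (c ⊕ d)) ⊜ ((c ⊕ (d ⊕ b)) ⊕ a)) refl _ _ _ _))
    (subst (λ e → dist v e ≤ lenFrom v vs) (sym (last-∷ v vs)) (dist≤lenFrom v vs)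
      +≤ detour≤walked A legal q∈ (Sum.[ q∉qs , q∉ ] ∘ ∈-++⁻ qs))

  -- Transports the invariant that nothing served by the end of a phase arrives later. It guarantees
  -- that the request defining the next anchor is still unserved when its phase begins.
  servedAfter-arrived : ∀ {β o served} A {B} → LegalFrom o served (A ++ B) →
                        All (λ e → proj₁ e ≤ β) A → All (λ q → arrival q ≤ β) served →
                        All (λ q → arrival q ≤ β) (servedAfter served A)
  servedAfter-arrived []      _                []              arrived = arrived
  servedAfter-arrived (_ ∷ A) (_ , ok , legal) (t≤β ∷ earlier) arrived =
    servedAfter-arrived A legal earlier (All.++⁺ (All.map (λ p → ≤-trans (proj₁ p) t≤β) ok) arrived)

  difference-antimono : ∀ t {τ β} → τ ≤ β → t - β ≤ t - τ
  difference-antimono t {τ} {β} τ≤β =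
    linear (≤-reflexive (x-y+y≡x t β) +≤ ≤-reflexive (sym (x-y+y≡x t τ)) +≤ τ≤β)
      (solve 5 (λ tβ tτ t τ β → (tβ ⊕ ((t ⊕ (tτ ⊕ τ)) ⊕ β)) ⊜ (tτ ⊕ (((tβ ⊕ β) ⊕ t) ⊕ τ))) refl _ _ _ _ _)

  waitAfter-antimono : ∀ {τ β} → τ ≤ β → ∀ e → waitAfter β e ≤ waitAfter τ e
  waitAfter-antimono τ≤β (t , C) =
    ⊓-glb (x⊓y≤x _ _) (≤-trans (x⊓y≤y _ _) (difference-antimono t τ≤β))

  costAfter-antimono : ∀ {τ β} → τ ≤ β → ∀ E → costAfter β E ≤ costAfter τ E
  costAfter-antimono τ≤β []      = ≤-refl
  costAfter-antimono τ≤β (e ∷ E) = +-monoʳ-≤ _ (waitAfter-antimono τ≤β e) +≤ costAfter-antimono τ≤β E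

  -- A request pending throughout [τ, β] makes its service event wait for all of it.
  costAfter-pending : ∀ {τ β o served q} E → τ ≤ β → LegalFrom o served E →
                      q ∉ served → arrival q ≤ τ → costAfter β E + β ≤ costAfter τ E + τ
  costAfter-pending [] τ≤β complete q∉ _ = contradiction (complete _) q∉
  costAfter-pending {τ} {β} {q = q} (e@(t , C) ∷ E) τ≤β (_ , _ , legal) q∉ a≤τ with q ∈? serves C
  -- The wait of `q` alone is at least t - τ, so the minimum in `waitAfter τ` equals t - τ, while
  -- cutting at β leaves at most t - β.
  ... | yes q∈C =
    linear (x⊓y≤y (maxWait t (serves C)) (t - β) +≤ ≤-reflexive (trans (x-y+y≡x t β) (sym (x-y+y≡x t τ)))
            +≤ ⊓-glb (≤-trans (difference-antimono t a≤τ) (t-arrival≤maxWait t q∈C)) ≤-refl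
            +≤ costAfter-antimono τ≤β E)
      (solve 9 (λ l wβ wτ cβ cτ tβ tτ β τ →
          ((((l ⊕ wβ) ⊕ cβ) ⊕ β) ⊕ (((tβ ⊕ (tτ ⊕ τ)) ⊕ wτ) ⊕ cτ))
          ⊜ ((((l ⊕ wτ) ⊕ cτ) ⊕ τ) ⊕ (((wβ ⊕ (tβ ⊕ β)) ⊕ tτ) ⊕ cβ))) refl _ _ _ _ _ _ _ _ _)
  ... | no  q∉C =
    linear (waitAfter-antimono τ≤β e +≤ costAfter-pending E τ≤β legal (Sum.[ q∉C , q∉ ] ∘ ∈-++⁻ (serves C)) a≤τ)
      (solve 7 (λ l wβ wτ cβ cτ β τ →
          ((((l ⊕ wβ) ⊕ cβ) ⊕ β) ⊕ (wτ ⊕ (cτ ⊕ τ)))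
          ⊜ ((((l ⊕ wτ) ⊕ cτ) ⊕ τ) ⊕ (wβ ⊕ (cβ ⊕ β)))) refl _ _ _ _ _ _ _)

  Sorted : List Event → Set
  Sorted = AllPairs (λ e f → proj₁ e ≤ proj₁ f)

  record Split (β : ℝ) (E : List Event) : Set where
    field
      {before after} : List Event
      splits  : E ≡ before ++ after
      earlier : All (λ e → proj₁ e ≤ β) before
      later   : All (λ e → β ≤ proj₁ e) after
      sorted  : Sorted after

  split : ∀ β {E} → Sorted E → Split β E
  split β [] = record { splits = refl ; earlier = [] ; later = [] ; sorted = [] }
  split β {(t , C) ∷ E} (t≤ ∷ sorted) with t ≤? β
  ... | yes t≤β = let open Split (split β sorted) renaming (sorted to sorted′) in
    record { splits = cong (_ ∷_) splits ; earlier = t≤β ∷ earlier ; later = later ; sorted = sorted′ }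
  ... | no  t≰β = record
    { splits  = refl
    ; earlier = []
    ; later   = ≰⇒≥ t≰β ∷ All.map (≤-trans (≰⇒≥ t≰β)) t≤
    ; sorted  = t≤ ∷ sorted
    }

  -- The two conclusions correspond to the two signs of the potential.
  displacement-bound : ∀ {s τ Δ} → Chain s τ Δ → ∀ {o served E} → Sorted E →
    All (λ e → τ ≤ proj₁ e) E → LegalFrom o served E → All (λ q → arrival q ≤ τ) served →
    Δ ≤ 4 · costAfter τ E + dist s o ×
    (∀ q → location q ≡ s → q ∉ served → arrival q ≤ τ → Δ + dist s o ≤ 4 · costAfter τ E)
  displacement-bound {s} {τ} done {o} {served} {E} _ later legal arrived =
    0≤+ (0≤n·x 4 (≤-trans (0≤walked E) w≤c)) (0≤dist s o) , pending
    where
    legal′ : LegalFrom o served (E ++ [])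
    legal′ = subst (LegalFrom o served) (sym (++-identityʳ E)) legal
    w≤c : walked E ≤ costAfter τ E
    w≤c = walked≤costAfter E legal′ later
    pending : ∀ q → location q ≡ s → q ∉ served → arrival q ≤ τ → 0# + dist s o ≤ 4 · costAfter τ E
    pending q refl q∉ _ =
      -- No phase is left, but `q` must still be served, so the remaining walk reaches s and pays
      -- for |s - o|.
      linear (detour≤walked E legal′ (legal-++ʳ E legal′ q) q∉ +≤ 0≤dist s (positionAfter o E)
              +≤ ≤-reflexive (dist-sym s o) +≤ w≤c +≤ 3 ·≤ (≤-trans (0≤walked E) w≤c))
        (solve 5 (λ so os sp w c →
            ((ε ⊕ so) ⊕ ((((w ⊕ sp) ⊕ os) ⊕ c) ⊕ 3 ⊗ c))
            ⊜ (4 ⊗ c ⊕ (((((os ⊕ sp) ⊕ ε) ⊕ so) ⊕ w) ⊕ 3 ⊗ ε))) refl _ _ _ _ _)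
  displacement-bound {s} {τ} (phase {Δ = Δ} q′ β late early long chain) {o} {served} {E} sorted later legal arrived
    with split β sorted
  ... | record { before = A ; after = B ; splits = refl ; earlier = A≤β ; later = β≤B ; sorted = sorted-B } =
    settled , pending
    where
    s′ o′ : Site
    s′ = location q′
    o′ = positionAfter o A
    w c : ℝ
    w = walked A
    c = costAfter β B
    τ≤β : τ ≤ β
    τ≤β = ≤-trans (≰⇒≥ late) early
    legal-B : LegalFrom o′ (servedAfter served A) B
    legal-B = legal-++ʳ A legal
    IH = displacement-bound chain sorted-B β≤B legal-B
           (servedAfter-arrived A legal A≤β (All.map (λ p → ≤-trans p τ≤β) arrived))
    IH₁ : Δ ≤ 4 · c + dist s′ o′
    IH₁ = proj₁ IH
    IH₂ : q′ ∉ servedAfter served A → Δ + dist s′ o′ ≤ 4 · c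
    IH₂ q′∉ = proj₂ IH q′ refl q′∉ early
    q′∉served : q′ ∉ served
    q′∉served q′∈ = late (All.lookup arrived q′∈)
    0≤w : 0# ≤ w
    0≤w = 0≤walked A
    w≤ : w ≤ costAfter τ A
    w≤ = walked≤costAfter A legal (All.++⁻ˡ A later)
    gain : 4 · w + 4 · c ≤ 4 · costAfter τ (A ++ B)
    gain = ≤-trans (4 ·≤ w≤ +≤ 4 ·≤ costAfter-antimono τ≤β B)
      (≤-reflexive (trans (solve 2 (λ a b → (4 ⊗ a ⊕ 4 ⊗ b) ⊜ 4 ⊗ (a ⊕ b)) refl _ _)
                          (cong (4 ·_) (sym (costAfter-++ τ A B)))))
    gain-pending : ∀ {q} → q ∉ servedAfter served A → arrival q ≤ τ →
                   4 · w + 4 · c + 2 · dist s s′ ≤ 4 · costAfter τ (A ++ B)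
    -- The event serving `q` lies in `B`. Its wait during [τ, β] is counted from τ but cut off from
    -- β on, and `long` turns 4 (β - τ) into at least 2 D.
    gain-pending q∉ a≤τ =
      linear (4 ·≤ w≤ +≤ 4 ·≤ costAfter-pending B τ≤β legal-B q∉ a≤τ +≤ long
              +≤ ≤-reflexive (cong (4 ·_) (sym (costAfter-++ τ A B))))
        (solve 8 (λ w a c b d e τ β →
            (((4 ⊗ w ⊕ 4 ⊗ c) ⊕ 2 ⊗ d) ⊕ (((4 ⊗ a ⊕ 4 ⊗ (b ⊕ τ)) ⊕ 4 ⊗ β) ⊕ 4 ⊗ e))
            ⊜ (4 ⊗ e ⊕ (((4 ⊗ w ⊕ 4 ⊗ (c ⊕ β)) ⊕ (2 ⊗ d ⊕ 4 ⊗ τ)) ⊕ 4 ⊗ (a ⊕ b)))) refl _ _ _ _ _ _ _ _)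
    detour′ : q′ ∈ servedAfter served A → dist o s′ + dist s′ o′ ≤ w
    detour′ q′∈ = detour≤walked A legal q′∈ q′∉served
    direct : dist o o′ ≤ w
    direct = displacement≤walked A legal
    via-o′ : dist s s′ ≤ dist s o′ + dist s′ o′
    via-o′ = subst (λ d → dist s s′ ≤ dist s o′ + d) (dist-sym o′ s′) (dist-triangle s o′ s′)

    settled : dist s s′ + Δ ≤ 4 · costAfter τ (A ++ B) + dist s o
    -- If S served `q′` in this phase, its walk went through s′ and pays for |os′| + |s′o′|.
    -- Otherwise the positive potential |s′o′| of the induction hypothesis completes a path from s
    -- through o and o′ to s′.
    settled with q′ ∈? servedAfter served A
    ... | yes q′∈ = linear (dist-triangle s o s′ +≤ IH₁ +≤ detour′ q′∈ +≤ gain +≤ 3 ·≤ 0≤w)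
      (solve 8 (λ D Δ C so os′ s′o′ w c →
          ((D ⊕ Δ) ⊕ (((((so ⊕ os′) ⊕ (4 ⊗ c ⊕ s′o′)) ⊕ w) ⊕ C) ⊕ 3 ⊗ w))
          ⊜ ((C ⊕ so) ⊕ ((((D ⊕ Δ) ⊕ (os′ ⊕ s′o′)) ⊕ (4 ⊗ w ⊕ 4 ⊗ c)) ⊕ 3 ⊗ ε))) refl _ _ _ _ _ _ _ _)
    ... | no  q′∉ = linear (via-o′ +≤ dist-triangle s o o′ +≤ IH₂ q′∉ +≤ direct +≤ gain +≤ 3 ·≤ 0≤w)
      (solve 9 (λ D Δ C so oo′ so′ s′o′ w c →
          ((D ⊕ Δ) ⊕ ((((((so′ ⊕ s′o′) ⊕ (so ⊕ oo′)) ⊕ 4 ⊗ c) ⊕ w) ⊕ C) ⊕ 3 ⊗ w))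
          ⊜ ((C ⊕ so) ⊕ (((((D ⊕ so′) ⊕ (Δ ⊕ s′o′)) ⊕ oo′) ⊕ (4 ⊗ w ⊕ 4 ⊗ c)) ⊕ 3 ⊗ ε)))
        refl _ _ _ _ _ _ _ _ _)

    pending : ∀ q → location q ≡ s → q ∉ served → arrival q ≤ τ →
              dist s s′ + Δ + dist s o ≤ 4 · costAfter τ (A ++ B)
    pending q refl q∉ a≤τ with q ∈? servedAfter served A | q′ ∈? servedAfter served A
    -- The walk passes through both anchors. Going from o to s is needed twice, once to cancel the
    -- potential and once to bound D through o, so walking is used three times; this is the largest
    -- demand on walking.
    ... | yes q∈ | yes q′∈ =
      linear (dist-triangle s o s′ +≤ IH₁ +≤ detour′ q′∈ +≤ 2 ·≤ detour≤walked A legal q∈ q∉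
              +≤ 2 ·≤ ≤-reflexive (dist-sym s o) +≤ 2 ·≤ 0≤dist s o′ +≤ gain +≤ 0≤w)
        (solve 10 (λ D Δ C so os os′ so′ s′o′ w c →
            (((D ⊕ Δ) ⊕ so) ⊕ ((((((((so ⊕ os′) ⊕ (4 ⊗ c ⊕ s′o′)) ⊕ w) ⊕ 2 ⊗ w) ⊕ 2 ⊗ os) ⊕ 2 ⊗ so′) ⊕ C) ⊕ w))
            ⊜ (C ⊕ (((((((D ⊕ Δ) ⊕ (os′ ⊕ s′o′)) ⊕ 2 ⊗ (os ⊕ so′)) ⊕ 2 ⊗ so) ⊕ 2 ⊗ ε) ⊕ (4 ⊗ w ⊕ 4 ⊗ c)) ⊕ ε)))
          refl _ _ _ _ _ _ _ _ _ _)
    ... | yes q∈ | no  q′∉ =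
      linear (via-o′ +≤ IH₂ q′∉ +≤ detour≤walked A legal q∈ q∉ +≤ ≤-reflexive (dist-sym s o) +≤ gain +≤ 3 ·≤ 0≤w)
        (solve 9 (λ D Δ C so os so′ s′o′ w c →
            (((D ⊕ Δ) ⊕ so) ⊕ ((((((so′ ⊕ s′o′) ⊕ 4 ⊗ c) ⊕ w) ⊕ os) ⊕ C) ⊕ 3 ⊗ w))
            ⊜ (C ⊕ (((((D ⊕ (Δ ⊕ s′o′)) ⊕ (os ⊕ so′)) ⊕ so) ⊕ (4 ⊗ w ⊕ 4 ⊗ c)) ⊕ 3 ⊗ ε)))
          refl _ _ _ _ _ _ _ _ _)
    -- With `q` pending throughout, nothing forces a visit to s. The comparison |so| ≤ D + |s′o|
    -- raises the debt to 2 D, which the waiting gain covers; the same holds in the last case.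
    ... | no  q∉A | yes q′∈ =
      linear (dist-triangle s s′ o +≤ ≤-reflexive (dist-sym s′ o) +≤ IH₁ +≤ detour′ q′∈
              +≤ gain-pending q∉A a≤τ +≤ 3 ·≤ 0≤w)
        (solve 9 (λ D Δ C so os′ s′o s′o′ w c →
            (((D ⊕ Δ) ⊕ so) ⊕ ((((((D ⊕ s′o) ⊕ os′) ⊕ (4 ⊗ c ⊕ s′o′)) ⊕ w) ⊕ C) ⊕ 3 ⊗ w))
            ⊜ (C ⊕ (((((so ⊕ s′o) ⊕ Δ) ⊕ (os′ ⊕ s′o′)) ⊕ ((4 ⊗ w ⊕ 4 ⊗ c) ⊕ 2 ⊗ D)) ⊕ 3 ⊗ ε)))
          refl _ _ _ _ _ _ _ _ _)
    ... | no  q∉A | no  q′∉ =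
      linear (dist-triangle s s′ o +≤ dist-triangle s′ o′ o +≤ ≤-reflexive (dist-sym o′ o) +≤ IH₂ q′∉ +≤ direct
              +≤ gain-pending q∉A a≤τ +≤ 3 ·≤ 0≤w)
        (solve 10 (λ D Δ C so oo′ o′o s′o s′o′ w c →
            (((D ⊕ Δ) ⊕ so) ⊕ (((((((D ⊕ s′o) ⊕ (s′o′ ⊕ o′o)) ⊕ oo′) ⊕ 4 ⊗ c) ⊕ w) ⊕ C) ⊕ 3 ⊗ w))
            ⊜ (C ⊕ ((((((so ⊕ s′o) ⊕ o′o) ⊕ (Δ ⊕ s′o′)) ⊕ oo′) ⊕ ((4 ⊗ w ⊕ 4 ⊗ c) ⊕ 2 ⊗ D)) ⊕ 3 ⊗ ε)))
          refl _ _ _ _ _ _ _ _ _ _)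

  events : Schedule Request → List Event
  events = Service.events I

  events-All : ∀ (P : ℝ → Set) S → All P (map Action.time S) → All (P ∘ proj₁) (events S)
  events-All P []      []       = []
  events-All P (A ∷ S) (pt ∷ p) =
    All.++⁺ (All.map⁺ (All.universal (λ _ → pt) (Action.components A))) (events-All P S p)

  events-sorted : ∀ S → AllPairs _≤_ (map Action.time S) → Sorted (events S)
  events-sorted []      []             = []
  events-sorted (A ∷ S) (t≤ ∷ ordered) = AllPairs.++⁺
    (AllPairs.map⁺ (simultaneous (Action.components A))) (events-sorted S ordered)
    (All.map⁺ (All.universal (λ _ → events-All (Action.time A ≤_) S t≤) (Action.components A)))
    where
    simultaneous : ∀ Cs → AllPairs (λ (_ _ : Component Request) → Action.time A ≤ Action.time A) Cs
    simultaneous []       = []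
    simultaneous (_ ∷ Cs) = All.universal (λ _ → ≤-refl) Cs ∷ simultaneous Cs

  -- Timestamps may be negative, so the start of a chain has to be moved below them.
  starting-time : ∀ τ ts → AllPairs _≤_ ts → ∃ λ τ′ → τ′ ≤ τ × All (τ′ ≤_) ts
  starting-time τ []       []           = τ , ≤-refl , []
  starting-time τ (t ∷ ts) (t≤ ∷ _) =
    τ ⊓ t , x⊓y≤x τ t , x⊓y≤y τ t ∷ All.map (≤-trans (x⊓y≤y τ t)) t≤

  displacement≤4·cost : ∀ {τ Δ S} → Chain s₀ τ Δ → Service.Feasible I S → Δ ≤ 4 · Service.cost I S
  displacement≤4·cost {τ} {Δ} {S} chain (ordered , legal)
    with pairs ← Linked⇒AllPairs ≤-trans ordered
    with τ′ , τ′≤τ , later ← starting-time τ (map Action.time S) pairs = ≤-trans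
    (proj₁ (displacement-bound (chain-weaken τ′≤τ chain) (events-sorted S pairs) (events-All (τ′ ≤_) S later) legal []))
    (linear (≤-reflexive (dist-refl s₀) +≤ 4 ·≤ costAfter≤totalCost τ′ (events S))
      (solve 3 (λ c d k → ((4 ⊗ c ⊕ d) ⊕ (ε ⊕ 4 ⊗ k)) ⊜ (4 ⊗ k ⊕ (d ⊕ 4 ⊗ c))) refl _ _ _))

  ≤84·OPT : ∀ {τ Δ k} → Chain s₀ τ Δ → k ≤ 21 · Δ → k ≤ 84 · Service.OPT I
  ≤84·OPT {k = k} chain k≤21Δ = ·-infimum 83 (proj₂ (Service.optimum I)) lower
    where
    lower : ∀ c → Service.Achievable I c → k ≤ 84 · c
    lower c (S , feasible , refl) = ≤-trans k≤21Δ
      (≤-trans (21 ·≤ displacement≤4·cost {S = S} chain feasible) (≤-reflexive (·-assocˡ c 21 4)))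

-- Inverting the traversal and the search used to locate members.

module _ {A : Set} where

  private
    sequence : List (Maybe A) → Maybe (List A)
    sequence = List.TraversableA.sequenceA Maybe.applicative

    sequence⁺ : List⁺ (Maybe A) → Maybe (List⁺ A)
    sequence⁺ = List⁺.TraversableA.sequenceA Maybe.applicative

  sequence-nothing : ∀ xs → sequence xs ≡ nothing → nothing ∈ xs
  sequence-nothing (nothing ∷ xs) _ = here refl
  sequence-nothing (just x ∷ xs)  _ with sequence xs in eq
  ... | nothing = there (sequence-nothing xs eq)

  sequence-just : ∀ xs {ys} → sequence xs ≡ just ys → xs ≡ map just ys
  sequence-just []            refl = refl
  sequence-just (just x ∷ xs) _    with sequence xs in eq
  sequence-just (just x ∷ xs) refl | just ys = cong (_ ∷_) (sequence-just xs eq)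

  sequence⁺-nothing : ∀ xs → sequence⁺ xs ≡ nothing → nothing ∈ toList xs
  sequence⁺-nothing (nothing ∷ xs) _ = here refl
  sequence⁺-nothing (just x ∷ xs)  _ with sequence xs in eq
  ... | nothing = there (sequence-nothing xs eq)

  sequence⁺-just : ∀ xs {ys} → sequence⁺ xs ≡ just ys → toList xs ≡ map just (toList ys)
  sequence⁺-just (just x ∷ xs) _    with sequence xs in eq
  sequence⁺-just (just x ∷ xs) refl | just ys = cong (_ ∷_) (sequence-just xs eq)

module _ {A : Set} {P : A → Set} (P? : ∀ x → Dec (P x)) where

  find-just : ∀ xs {x} → find P? xs ≡ just x → x ∈ xs × P x
  find-just (x ∷ xs) eq with P? x
  find-just (x ∷ xs) refl | yes px = here refl , px
  find-just (x ∷ xs) eq   | no  _  = let x∈ , px = find-just xs eq in there x∈ , px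

  find-nothing : ∀ xs {x} → find P? xs ≡ nothing → x ∈ xs → ¬ P x
  find-nothing (x ∷ xs) eq x∈ with P? x
  find-nothing (x ∷ xs) eq (here refl) | no ¬px = ¬px
  find-nothing (x ∷ xs) eq (there x∈)  | no _   = find-nothing xs eq x∈

-- Invariants and cost of the algorithm's epochs, sweeps and collections.

module UpperBound (R : RealNumbers) (X : FiniteSubset R) (s₀ : Line.Site R X)
                  (I : BlindElectiveService.Input R X s₀) where
  open Reals R
  open Geometry R X
  open LowerBound R X s₀ I
  private module Service = BlindElectiveService R X s₀
  open Service.Input I
  open Service using (Config; config)
  open Component
  open DyadicAnchorExploration R X {Request} Fin._≟_
  open Phase
  open DecMembership {A = Request} Fin._≟_ using (_∈?_)
  open DecMembership {A = Site} Fin._≟_ using () renaming (_∈?_ to _∈ˢ?_)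

  collects : ∀ s ls → Collects s (toList ls) (proj₁ (collect s ls)) (proj₂ (collect s ls))
  collects s ls with dist s (foldr₁ leftmost ls) ≤? dist s (foldr₁ rightmost ls)
  ... | yes l≤r = near-then-far (rightmost∈ ls) (λ z∈ → inj₁ (leftmost≤ ls z∈ , ≤rightmost ls z∈)) l≤r
  ... | no  l≰r = near-then-far (leftmost∈ ls) (λ z∈ → inj₂ (leftmost≤ ls z∈ , ≤rightmost ls z∈)) (≰⇒≥ l≰r)

  infix 4 _<_
  _<_ : ℝ → ℝ → Set
  x < y = ¬ (y ≤ x)

  <-trans : ∀ {x y z} → x < y → y < z → x < z
  <-trans x<y y<z z≤x = x<y (≤-trans (≰⇒≥ y<z) z≤x)

  revealed : ℝ → List Request → Walk → List Sighting
  revealed = Service.revealed I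

  module _ {t : ℝ} {served : List Request} {w : Walk} where

    Revealed : Request → Set
    Revealed q = arrival q ≤ t × q ∉ served × location q ∈ toList w

    revealed? : ∀ q → Dec (Revealed q)
    revealed? q = (arrival q ≤? t) ×-dec ¬? (q ∈? served) ×-dec (location q ∈ˢ? toList w)

    revealed⁺ : ∀ {q} → Revealed q → (q , location q) ∈ revealed t served w
    revealed⁺ {q} r = ∈-map⁺ (λ q → q , location q) (∈-filter⁺ revealed? (∈-allFin q) r)

    revealed⁻ : ∀ {q x} → (q , x) ∈ revealed t served w → x ≡ location q × Revealed q
    revealed⁻ qx∈ with ∈-map⁻ (λ q → q , location q) qx∈
    ... | q , q∈ , refl = refl , proj₂ (∈-filter⁻ revealed? {xs = allFin requests} q∈)

    identities⁻ : ∀ {q} → q ∈ identities (revealed t served w) → Revealed q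
    identities⁻ q∈ with ∈-map⁻ proj₁ q∈
    ... | _ , qx∈ , refl = proj₂ (revealed⁻ qx∈)

  maxWait≤ : ∀ {t b} qs → 0# ≤ b → All (λ q → t ≤ arrival q + b) qs → maxWait t qs ≤ b
  maxWait≤         []       0≤b _ = 0≤b
  maxWait≤ {t} {b} (q ∷ qs) 0≤b soon = foldr₁-preserves _⊔_ (_≤ b) ⊔-lub
    (All.map⁺ (All.map (λ {q} t≤ → +-cancelʳ-≤ (arrival q)
      (subst₂ _≤_ (sym (x-y+y≡x t (arrival q))) (+-comm (arrival q) b) t≤)) soon))

  -- τ is the end of the previous phase.
  Member : Site → List Request → ℝ → ℝ → Request × ℝ → Set
  Member s served τ now (q , a) =
    a ≡ arrival q × q ∉ served × location q ≢ s × τ < arrival q × arrival q ≤ now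

  -- `tracked` does double duty: it shows that a check meets no forgotten older request, and that
  -- every request is served once the run halts.
  record Consistent (now : ℝ) (ts : List ℝ) (served : List Request) (s : Site) (τ : ℝ)
                    (ms : List (Request × ℝ)) : Set where
    field
      ascending : AllPairs _<_ (now ∷ ts)
      started   : τ ≤ now
      arrived   : All (λ q → arrival q ≤ now) served
      tracked   : ∀ q → q ∈ served ⊎ q ∈ map proj₁ ms ⊎ arrival q ∈ ts
      awaiting  : All (Member s served τ now) ms

  -- `radius (sweepsDone φ)` is the radius of the sweep still to come. `far` holds before that sweep
  -- is made, so it is available when the sweep turns out to be the last; `soon` says that the sweep
  -- is not overdue.
  record Searching (now : ℝ) (ts : List ℝ) (served : List Request) (s : Site) (τ : ℝ) (φ : Phase) : Set where
    field
      consistent : Consistent now ts served s τ (toList (members φ))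
      located    : All (λ (q , x) → x ≡ location q × 2 · dist s x ≤ 4 · radius (sweepsDone φ)) (known φ)
      soon       : All (λ (q , a) → now ≤ a + radius (sweepsDone φ)) (toList (members φ))
      far        : ∃ λ q → q ∈ map proj₁ (toList (members φ)) × radius (sweepsDone φ) ≤ 2 · dist s (location q)
    open Consistent consistent public

  nextSweep≤ : ∀ φ {q a} → (q , a) ∈ toList (members φ) → nextSweep φ ≤ a + radius (sweepsDone φ)
  nextSweep≤ φ {a = a} q∈ = foldr₁-reaches _⊓_ (_≤ a)
    (λ y x≤a → ≤-trans (x⊓y≤x _ y) x≤a) (λ x y≤a → ≤-trans (x⊓y≤y x _) y≤a)
    (∈-map⁺ proj₂ q∈) ≤-refl +≤ ≤-refl

  ≤nextSweep : ∀ φ {x} → All (λ (q , a) → x ≤ a + radius (sweepsDone φ)) (toList (members φ)) → x ≤ nextSweep φ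
  ≤nextSweep φ {x} x≤ = foldr₁-preserves _⊓_ (λ a → x ≤ a + radius (sweepsDone φ))
    (selective-closed ⊓-sel (λ a → x ≤ a + radius (sweepsDone φ))) (All.map⁺ x≤)

  -- The leading 4 r is the credit for earlier sweeps, whose radii sum to less than r. With the last
  -- sweep and the wait this makes 9 r ≤ 18 D, and the collection adds 3 D.
  phase-cost : ∀ {r D Δ l l′ m c} → l ≤ 4 · r → l′ ≤ 3 · D → m ≤ r → 0# + c ≤ 21 · Δ → r ≤ 2 · D →
               4 · r + (l + 0# + (l′ + m + c)) ≤ 21 · (D + Δ)
  phase-cost {r} {D} {Δ} {l} {l′} {m} {c} l≤ l′≤ m≤ c≤ r≤ =
    linear (l≤ +≤ l′≤ +≤ m≤ +≤ c≤ +≤ 9 ·≤ r≤)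
      (solve 7 (λ r D Δ l l′ m c →
          ((4 ⊗ r ⊕ ((l ⊕ ε) ⊕ ((l′ ⊕ m) ⊕ c))) ⊕ ((((4 ⊗ r ⊕ 3 ⊗ D) ⊕ r) ⊕ 21 ⊗ Δ) ⊕ 9 ⊗ 2 ⊗ D))
          ⊜ (21 ⊗ (D ⊕ Δ) ⊕ ((((l ⊕ l′) ⊕ m) ⊕ (ε ⊕ c)) ⊕ 9 ⊗ r))) refl r D Δ l l′ m c)

  -- The credit pays for the sweeps already made in the current phase.
  record Outcome (c : Config I) (now : ℝ) (served : List Request) (s : Site) (τ credit : ℝ) : Set where
    field
      {schedule} : Schedule Request
      run        : Service.Run I c schedule
      ordered    : Linked _≤_ (now ∷ map Action.time schedule)
      legal      : LegalFrom s served (events schedule)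
      {Δ}        : ℝ
      chain      : Chain s τ Δ
      cheap      : credit + totalCost (events schedule) ≤ 21 · Δ

  module Epoch {now t ts served s τ ms} (before : Consistent now (t ∷ ts) served s τ ms) where
    open Consistent before

    seen : List Sighting
    seen = revealed t served (check s)

    served′ : List Request
    served′ = identities seen ++ served

    new : List (Request × ℝ)
    new = unresolved t (Service.epoch I t) seen

    now<t : now < t
    now<t = All.head (AllPairs.head ascending)

    Unresolved : Request → Set
    Unresolved q = q ∉ identities seen

    unresolved? : ∀ q → Dec (Unresolved q)
    unresolved? q = ¬? (q ∈? identities seen)

    not-served-before : ∀ {q} → arrival q ≡ t → q ∉ served
    not-served-before refl q∈ = now<t (All.lookup arrived q∈)

    -- An older pending request would be a member of the phase, and members lie off the anchor.
    -- Hence a check serves only its own epoch, at zero waiting cost.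
    seen-arrival : ∀ {q} → q ∈ identities seen → arrival q ≡ t
    seen-arrival {q} q∈ with identities⁻ q∈
    ... | a≤t , q∉ , here at-s with tracked q
    ...   | inj₁ q∈served = contradiction q∈served q∉
    ...   | inj₂ (inj₂ (here a≡t)) = a≡t
    ...   | inj₂ (inj₂ (there a∈)) = contradiction a≤t (All.lookup (AllPairs.head (AllPairs.tail ascending)) a∈)
    ...   | inj₂ (inj₁ q∈ms) with ∈-map⁻ proj₁ q∈ms
    ...     | _ , m∈ , refl = contradiction at-s (proj₁ (proj₂ (proj₂ (All.lookup awaiting m∈))))

    new⁻ : ∀ {q a} → (q , a) ∈ new → a ≡ t × arrival q ≡ t × q ∉ identities seen
    new⁻ q∈ with ∈-map⁻ (_, t) q∈
    ... | q , q∈epoch , refl = let q∈′ , q∉seen = ∈-filter⁻ unresolved? {xs = Service.epoch I t} q∈epoch in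
      refl , proj₂ (∈-filter⁻ (λ q → arrival q ≟ t) {xs = allFin requests} q∈′) , q∉seen

    new⁺ : ∀ {q} → arrival q ≡ t → q ∉ identities seen → q ∈ map proj₁ new
    new⁺ {q} a≡t q∉ = ∈-map⁺ proj₁ (∈-map⁺ (_, t)
      (∈-filter⁺ unresolved? (∈-filter⁺ (λ q → arrival q ≟ t) (∈-allFin q) a≡t) q∉))

    member-old : ∀ {m} → Member s served τ now m → Member s served′ τ t m
    member-old (a≡ , q∉ , q≢s , τ<a , a≤now) =
      a≡ , Sum.[ (λ q∈ → q≢s (seen-at-s q∈)) , q∉ ] ∘ ∈-++⁻ (identities seen) , q≢s , τ<a ,
      ≤-trans a≤now (≰⇒≥ now<t)
      where
      seen-at-s : ∀ {q} → q ∈ identities seen → location q ≡ s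
      seen-at-s q∈ with identities⁻ q∈
      ... | _ , _ , here at-s = at-s

    member-new : ∀ {m} → m ∈ new → Member s served′ τ t m
    member-new {q , a} m∈ with new⁻ m∈
    ... | refl , a≡t , q∉seen =
      sym a≡t , Sum.[ q∉seen , not-served-before a≡t ] ∘ ∈-++⁻ (identities seen) ,
      (λ at-s → q∉seen (∈-map⁺ proj₁ (revealed⁺ (≤-reflexive a≡t , not-served-before a≡t , here at-s)))) ,
      subst (τ <_) (sym a≡t) (λ t≤τ → now<t (≤-trans t≤τ started)) , ≤-reflexive a≡t

    after : Consistent t ts served′ s τ (ms ++ new)
    after = record
      { ascending = AllPairs.tail ascending
      ; started   = ≤-trans started (≰⇒≥ now<t)
      ; arrived   = All.++⁺ (All.tabulate (≤-reflexive ∘ seen-arrival)) (All.map (λ a≤ → ≤-trans a≤ (≰⇒≥ now<t)) arrived)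
      ; tracked   = tracked′
      ; awaiting  = All.++⁺ (All.map member-old awaiting) (All.tabulate member-new)
      }
      where
      tracked′ : ∀ q → q ∈ served′ ⊎ q ∈ map proj₁ (ms ++ new) ⊎ arrival q ∈ ts
      tracked′ q with tracked q
      ... | inj₁ q∈ = inj₁ (∈-++⁺ʳ (identities seen) q∈)
      ... | inj₂ (inj₁ q∈) = inj₂ (inj₁ (subst (q ∈_) (sym (map-++ proj₁ ms new)) (∈-++⁺ˡ q∈)))
      ... | inj₂ (inj₂ (there a∈)) = inj₂ (inj₂ a∈)
      ... | inj₂ (inj₂ (here a≡t)) with q ∈? identities seen
      ...   | yes q∈ = inj₁ (∈-++⁺ˡ q∈)
      ...   | no  q∉ = inj₂ (inj₁ (subst (q ∈_) (sym (map-++ proj₁ ms new)) (∈-++⁺ʳ (map proj₁ ms) (new⁺ a≡t q∉))))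

    prepend : ∀ {p credit} →
      Service.step I (config (t ∷ ts) served (state s p)) ≡
        just (Service.epochStep I t ts served (state s p)) →
      Outcome (config ts served′ (afterCheck (state s p) t (Service.epoch I t) seen)) t served′ s τ credit →
      Outcome (config (t ∷ ts) served (state s p)) now served s τ credit
    prepend step-eq rest = record
      { run     = step-eq Service.∷ run
      ; ordered = ≰⇒≥ now<t ∷ ordered
      ; legal   = refl , All.tabulate identities⁻ , legal
      ; chain   = chain
      ; cheap   = ≤-trans
          (linear (maxWait≤ {t} {0#} (identities seen) ≤-refl
              (All.tabulate (λ q∈ → ≤-reflexive (trans (sym (seen-arrival q∈)) (sym (+-identityʳ _))))))
            (solve 3 (λ k w c → ((k ⊕ ((ε ⊕ w) ⊕ c)) ⊕ ε) ⊜ ((k ⊕ c) ⊕ w)) refl _ _ _))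
          cheap
      }
      where open Outcome rest

  search-on : ∀ {now t ts served s τ φ} (searching : Searching now (t ∷ ts) served s τ φ) → t ≤ nextSweep φ →
              let open Epoch (Searching.consistent searching) in
              Searching t ts served′ s τ (record φ { members = members φ ⁺++ new })
  search-on {φ = φ} searching t≤ = record
    { consistent = after
    ; located    = located
    ; soon       = All.++⁺ (All.tabulate (λ m∈ → ≤-trans t≤ (nextSweep≤ φ m∈)))
                           (All.tabulate (λ m∈ → subst (λ a → _ ≤ a + radius (sweepsDone φ)) (sym (proj₁ (new⁻ m∈)))
                             (≤-trans (≤-reflexive (sym (+-identityʳ _))) (+-monoʳ-≤ _ (0≤radius (sweepsDone φ))))))
    ; far        = let q , q∈ , d = far in
                   q , subst (q ∈_) (sym (map-++ proj₁ (toList (members φ)) new)) (∈-++⁺ˡ q∈) , d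
    }
    where
    open Searching searching
    open Epoch consistent

  newPhase : List⁺ (Request × ℝ) → Phase
  newPhase ms = record { members = ms ; sweepsDone = 0 ; known = [] }

  search-new : ∀ {t ts served s τ} ms → Consistent t ts served s τ (toList ms) →
               All (λ (q , a) → a ≡ t) (toList ms) → Searching t ts served s τ (newPhase ms)
  search-new {t} {s = s} ms@((q , _) ∷ _) consistent fresh = record
    { consistent = consistent
    ; located    = []
    ; soon       = All.map (λ { refl → ≤-trans (≤-reflexive (sym (+-identityʳ _))) (+-monoʳ-≤ _ (0≤radius 0)) }) fresh
    -- The first radius is `δ`, and the check has removed every request at the anchor, so any member
    -- is at least `δ` away.
    ; far        = q , here refl , ≤-trans (≤-reflexive (+-identityʳ δ)) (≤-trans δ≤d
        (linear (0≤dist s (location q)) (solve 1 (λ d → (d ⊕ d) ⊜ (2 ⊗ d ⊕ ε)) refl _)))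
    }
    where
    δ≤d : δ ≤ dist s (location q)
    δ≤d = δ≤dist (λ eq → proj₁ (proj₂ (proj₂ (All.head (Consistent.awaiting consistent)))) (sym eq))


  -- The body of `locate` with the list of sightings made a variable, so that the search can be
  -- analysed by cases; `locate φ q` unfolds to it.
  find-sighting : Request → List Sighting → Maybe Site
  find-sighting q seen = Maybe.map proj₂ (find (λ (p , _) → p Fin.≟ q) seen)

  find-sighting-just : ∀ q seen {x} → find-sighting q seen ≡ just x → (q , x) ∈ seen
  find-sighting-just q seen eq with find (λ (p , _) → p Fin.≟ q) seen in found
  find-sighting-just q seen refl | just (p , x) with find-just (λ (p , _) → p Fin.≟ q) seen found
  ... | px∈ , refl = px∈

  find-sighting-nothing : ∀ q seen {x} → find-sighting q seen ≡ nothing → (q , x) ∉ seen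
  find-sighting-nothing q seen eq qx∈ with find (λ (p , _) → p Fin.≟ q) seen in found
  ... | nothing = find-nothing (λ (p , _) → p Fin.≟ q) seen found qx∈ refl

  locations-nothing : ∀ φ → locations φ ≡ nothing →
                      ∃ λ m → m ∈ toList (members φ) × locate φ (proj₁ m) ≡ nothing
  locations-nothing φ eq
    with ∈-map⁻ (locate φ ∘ proj₁) (sequence⁺-nothing (List⁺.map (locate φ ∘ proj₁) (members φ)) eq)
  ... | m , m∈ , nothing≡ = m , m∈ , sym nothing≡

  module _ φ {ls} (eq : locations φ ≡ just ls) where

    all-located : map (locate φ ∘ proj₁) (toList (members φ)) ≡ map just (toList ls)
    all-located = sequence⁺-just (List⁺.map (locate φ ∘ proj₁) (members φ)) eq

    locations-complete : ∀ {m} → m ∈ toList (members φ) → ∃ λ x → x ∈ toList ls × locate φ (proj₁ m) ≡ just x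
    locations-complete {m} m∈ = ∈-map⁻ just (subst (locate φ (proj₁ m) ∈_) all-located (∈-map⁺ (locate φ ∘ proj₁) m∈))

    locations-sound : ∀ {x} → x ∈ toList ls → ∃ λ m → m ∈ toList (members φ) × locate φ (proj₁ m) ≡ just x
    locations-sound {x} x∈ with ∈-map⁻ (locate φ ∘ proj₁) (subst (just x ∈_) (sym all-located) (∈-map⁺ just x∈))
    ... | m , m∈ , just≡ = m , m∈ , sym just≡

  module Sweep {now ts served s τ φ} (searching : Searching now ts served s τ φ)
               (next : All (nextSweep φ <_) ts) where
    open Searching searching
    open Window s (0≤radius (sweepsDone φ))

    T r : ℝ
    T = nextSweep φ
    r = radius (sweepsDone φ)

    seen : List Sighting
    seen = revealed T served (sweep s φ)

    φ′ : Phase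
    φ′ = record-sweep φ seen

    now≤T : now ≤ T
    now≤T = ≤nextSweep φ soon

    ascending′ : AllPairs _<_ (T ∷ ts)
    ascending′ = next ∷ AllPairs.tail ascending

    awaited : ∀ {q} → q ∈ map proj₁ (toList (members φ)) → ∃ λ a → (q , a) ∈ toList (members φ) × Member s served τ now (q , a)
    awaited q∈ with ∈-map⁻ proj₁ q∈
    ... | (_ , a) , m∈ , refl = a , m∈ , All.lookup awaiting m∈

    r≤radius-suc : r ≤ radius (suc (sweepsDone φ))
    r≤radius-suc = subst (r ≤_) (sym (radius-suc (sweepsDone φ)))
      (linear (0≤radius (sweepsDone φ)) (solve 1 (λ r → (r ⊕ r) ⊜ (2 ⊗ r ⊕ ε)) refl r))

    tour≡sweep : tour ≡ sweep s φ
    tour≡sweep = refl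

    sweep-covers : ∀ {z} → dist s z ≤ r → z ∈ toList (sweep s φ)
    sweep-covers {z} d≤r = subst (λ w → z ∈ toList w) tour≡sweep (tour-covers d≤r)

    sweep-near : ∀ {z} → z ∈ toList (sweep s φ) → 2 · dist s z ≤ 4 · r
    sweep-near {z} z∈ = tour-visits-near (subst (λ w → z ∈ toList w) (sym tour≡sweep) z∈)

    len-sweep : len (sweep s φ) ≤ 4 · r
    len-sweep = subst (λ w → len w ≤ 4 · r) tour≡sweep len-tour

    last-sweep : last (sweep s φ) ≡ s
    last-sweep = subst (λ w → last w ≡ s) tour≡sweep last-tour

    located′ : All (λ (q , x) → x ≡ location q × 2 · dist s x ≤ 4 · r) (known φ′)
    located′ = All.++⁺ located (All.tabulate sighted)
      where
      sighted : ∀ {qx} → qx ∈ seen → proj₂ qx ≡ location (proj₁ qx) × 2 · dist s (proj₂ qx) ≤ 4 · r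
      sighted {q , x} qx∈ = let x≡ , _ , _ , q∈sweep = revealed⁻ {T} {served} {sweep s φ} {q} {x} qx∈ in
        x≡ , subst (λ x → 2 · dist s x ≤ 4 · r) (sym x≡)
               (sweep-near q∈sweep)

    locate-just : ∀ q {x} → locate φ′ q ≡ just x → x ≡ location q × 2 · dist s x ≤ 4 · r
    locate-just q eq = All.lookup located′ (find-sighting-just q (known φ′) eq)

    -- A member is still pending at the sweep, so if it lay within r the sweep would have revealed
    -- it.
    locate-nothing : ∀ {q} → q ∈ map proj₁ (toList (members φ)) → locate φ′ q ≡ nothing → r < dist s (location q)
    locate-nothing {q} q∈ eq d≤r =
      let _ , _ , (_ , q∉ , _ , _ , a≤now) = awaited q∈ in
      find-sighting-nothing q (known φ′) eq
        (∈-++⁺ʳ (known φ) (revealed⁺ {T} {served} {sweep s φ} (≤-trans a≤now now≤T , q∉ , sweep-covers d≤r)))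

    undiscovered : locations φ′ ≡ nothing → ∃ λ q → q ∈ map proj₁ (toList (members φ)) × r < dist s (location q)
    undiscovered eq = let (q , _) , m∈ , lost = locations-nothing φ′ eq in
      q , ∈-map⁺ proj₁ m∈ , locate-nothing (∈-map⁺ proj₁ m∈) lost

    search-further : locations φ′ ≡ nothing → Searching T ts served s τ φ′
    search-further eq = record
      { consistent = record
        { ascending = ascending′
        ; started   = ≤-trans started now≤T
        ; arrived   = All.map (λ a≤ → ≤-trans a≤ now≤T) arrived
        ; tracked   = tracked
        ; awaiting  = All.map (λ (a≡ , q∉ , q≢s , τ<a , a≤) → a≡ , q∉ , q≢s , τ<a , ≤-trans a≤ now≤T) awaiting
        }
      ; located    = All.map (λ (x≡ , d≤) → x≡ , ≤-trans d≤ (4 ·≤ r≤radius-suc)) located′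
      ; soon       = All.tabulate (λ m∈ → ≤-trans (nextSweep≤ φ m∈) (+-monoʳ-≤ _ r≤radius-suc))
      ; far        = let q , q∈ , r<d = undiscovered eq in
                     q , q∈ , ≤-trans (≤-reflexive (radius-suc (sweepsDone φ))) (2 ·≤ ≰⇒≥ r<d)
      }

    -- The outcome of the search is abstracted so that `sweep-now` can split on a variable.
    -- `Steps-to` also hides how `step` reached the sweep: no epoch left, or the next one too late.
    result : Maybe (List⁺ Site) → Action Request × Config I
    result ls = action T (component (sweep s φ) [] ∷ proj₁ (finish s φ′ ls)) ,
                config ts (concatMap serves (proj₁ (finish s φ′ ls)) ++ served) (proj₂ (finish s φ′ ls))

    Steps-to : Maybe (List⁺ Site) → Set
    Steps-to ls = Service.step I (config ts served (state s (just φ))) ≡ just (result ls)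

    -- The credit balances: 4 r in hand and at most 4 r for this sweep are covered by the 4 (2 r)
    -- belonging to the next radius.
    prepend-sweep : Steps-to nothing →
      Outcome (config ts served (state s (just φ′))) T served s τ (4 · radius (sweepsDone φ′)) →
      Outcome (config ts served (state s (just φ))) now served s τ (4 · r)
    prepend-sweep step-eq rest = record
      { run     = step-eq Service.∷ run
      ; ordered = now≤T ∷ ordered
      ; legal   = refl , [] , subst (λ v → LegalFrom v served _) (sym last-sweep) legal
      ; chain   = chain
      ; cheap   = ≤-trans (linear (len-sweep +≤ ≤-reflexive (sym (cong (4 ·_) (radius-suc (sweepsDone φ)))))
          (solve 4 (λ r l c r₂ → ((4 ⊗ r ⊕ ((l ⊕ ε) ⊕ c)) ⊕ (4 ⊗ r ⊕ r₂)) ⊜ ((r₂ ⊕ c) ⊕ (l ⊕ 4 ⊗ 2 ⊗ r))) refl _ _ _ _))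
        cheap
      }
      where open Outcome rest

    module Collection {ls} (eq : locations φ′ ≡ just ls) where
      w : Walk
      w = proj₁ (collect s ls)

      s′ : Site
      s′ = proj₂ (collect s ls)

      ids : List Request
      ids = map proj₁ (toList (members φ))

      open Collects (collects s ls)

      location∈ : ∀ {q} → q ∈ ids → location q ∈ toList ls
      location∈ {q} q∈ = let _ , m∈ , _ = awaited q∈
                             x , x∈ , found = locations-complete φ′ eq m∈ in
        subst (_∈ toList ls) (proj₁ (locate-just q found)) x∈

      attained : ∃ λ q → q ∈ ids × s′ ≡ location q × 2 · dist s s′ ≤ 4 · r
      attained = let (q , _) , m∈ , found = locations-sound φ′ eq target in
        q , ∈-map⁺ proj₁ m∈ , locate-just q found

      served′ : List Request
      served′ = ids ++ served

      idle-after : Consistent T ts served′ s′ T []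
      idle-after = record
        { ascending = ascending′
        ; started   = ≤-refl
        ; arrived   = All.++⁺ (All.tabulate (λ q∈ → ≤-trans (proj₂ (proj₂ (proj₂ (proj₂ (proj₂ (proj₂ (awaited q∈))))))) now≤T))
                              (All.map (λ a≤ → ≤-trans a≤ now≤T) arrived)
        ; tracked   = λ q → Sum.[ inj₁ ∘ ∈-++⁺ʳ ids , Sum.[ inj₁ ∘ ∈-++⁺ˡ , inj₂ ∘ inj₂ ]′ ]′ (tracked q)
        ; awaiting  = []
        }

      r≤2D : r ≤ 2 · dist s s′
      r≤2D = let q , q∈ , r≤ = far in ≤-trans r≤ (2 ·≤ farthest (location∈ q∈))

      servable : ∀ {q} → q ∈ ids → Service.Servable I T served w q
      servable q∈ = let _ , _ , (_ , q∉ , _ , _ , a≤now) = awaited q∈ in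
        ≤-trans a≤now now≤T , q∉ , covers (location∈ q∈)

      wait≤ : maxWait T ids ≤ r
      wait≤ = maxWait≤ {T} {r} ids (0≤radius (sweepsDone φ)) (All.tabulate soon-enough)
        where
        soon-enough : ∀ {q} → q ∈ ids → T ≤ arrival q + r
        soon-enough q∈ = let _ , m∈ , (a≡ , _) = awaited q∈ in
          subst (λ a → T ≤ a + r) a≡ (nextSweep≤ φ m∈)

      -- All members arrived after τ, so the clock α + r cannot ring before τ + r. The phase thus
      -- lasts at least r, which is the waiting that a pending request contributes.
      τ+r≤T : τ + r ≤ T
      τ+r≤T = ≤nextSweep φ (All.map (λ { (refl , _ , _ , τ<a , _) → ≰⇒≥ τ<a +≤ ≤-refl }) awaiting)

      extend-chain : ∀ {Δ} → Chain s′ T Δ → Chain s τ (dist s s′ + Δ)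
      extend-chain {Δ} chain =
        let q , q∈ , at-q , near-s = attained
            _ , _ , (_ , _ , _ , τ<a , a≤now) = awaited q∈
        in subst (λ x → Chain x T Δ → Chain s τ (dist s x + Δ)) (sym at-q)
             (phase q T τ<a (≤-trans a≤now now≤T)
               (≤-trans (subst (λ x → 2 · dist s x ≤ 4 · r) at-q near-s +≤ ≤-refl)
                 (linear (4 ·≤ τ+r≤T)
                   (solve 3 (λ τ r T → ((4 ⊗ r ⊕ 4 ⊗ τ) ⊕ 4 ⊗ T) ⊜ (4 ⊗ T ⊕ 4 ⊗ (τ ⊕ r))) refl τ r T))))
             chain

      prepend-collection : Steps-to (just ls) →
        Outcome (config ts served′ (state s′ nothing)) T served′ s′ T 0# →
        Outcome (config ts served (state s (just φ))) now served s τ (4 · r)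
      prepend-collection step-eq rest = record
        { run     = step-eq Service.∷ subst (λ ids → Service.Run I (config ts (ids ++ served) (state s′ nothing)) schedule)
                                            (sym (++-identityʳ ids)) run
        ; ordered = now≤T ∷ ordered
        ; legal   = refl , [] , trans begins (sym last-sweep) , All.tabulate servable ,
                    subst (λ v → LegalFrom v served′ (events schedule)) (sym ends) legal
        ; chain   = extend-chain chain
        ; cheap   = phase-cost len-sweep short wait≤ cheap r≤2D
        }
        where open Outcome rest

-- Termination of the run and assembly of the bound.

module Algorithm (R : RealNumbers) (X : FiniteSubset R) (s₀ : Line.Site R X)
                 (I : BlindElectiveService.Input R X s₀) where
  open Reals R
  open Geometry R X
  open LowerBound R X s₀ I using (events; done; Chain; ≤84·OPT)
  open UpperBound R X s₀ I
  private module Service = BlindElectiveService R X s₀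
  open Service.Input I
  open Service using (Config; config)
  open DyadicAnchorExploration R X {Request} Fin._≟_ hiding (module State)
  open Phase

  -- Fuel plus sweeps done stays constant during a phase, so when the fuel is gone the upcoming
  -- sweep covers all of X.
  Covers-by : ℕ → Phase → Set
  Covers-by fuel φ = Covering (fuel ℕ.+ sweepsDone φ)

  -- The mutual recursion descends lexicographically: each epoch consumes `ts`, and each
  -- unsuccessful sweep between epochs consumes fuel, which is renewed only when a phase begins,
  -- after another epoch has been consumed.
  idle : ∀ ts {now served s τ} → Consistent now ts served s τ [] →
         Outcome (config ts served (state s nothing)) now served s τ 0#
  begin-phase : ∀ ts {t served s τ} us → Consistent t ts served s τ us → All (λ (q , a) → a ≡ t) us →
                Outcome (config ts served (state s (extend nothing us))) t served s τ 0#
  busy : ∀ ts fuel {now served s τ φ} → Covers-by fuel φ → Searching now ts served s τ φ →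
         Outcome (config ts served (state s (just φ))) now served s τ (4 · radius (sweepsDone φ))
  sweep-now : ∀ ts fuel {now served s τ φ} → Covers-by fuel φ → (searching : Searching now ts served s τ φ)
              (next : All (nextSweep φ <_) ts) (let open Sweep searching next) →
              ∀ ls → locations φ′ ≡ ls → Steps-to ls →
              Outcome (config ts served (state s (just φ))) now served s τ (4 · radius (sweepsDone φ))

  idle [] consistent = record
    { run     = Service.halt refl
    ; ordered = [-]
    ; legal   = λ q → Sum.[ id , Sum.[ (λ ()) , (λ ()) ]′ ]′ (tracked q)
    ; chain   = done
    ; cheap   = ≤-reflexive (solve 0 ((ε ⊕ ε) ⊜ (21 ⊗ ε)) refl)
    }
    where open Consistent consistent
  idle (t ∷ ts) consistent = prepend refl (begin-phase ts new after (All.tabulate (proj₁ ∘ new⁻)))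
    where open Epoch consistent

  begin-phase ts []       consistent fresh = idle ts consistent
  begin-phase ts (u ∷ us) consistent fresh = record
    { run     = run
    ; ordered = ordered
    ; legal   = legal
    ; chain   = chain
    -- No sweep has been made yet, so the credit 4 δ is slack and is dropped.
    ; cheap   = ≤-trans (0≤n·x 4 (0≤radius 0) +≤ ≤-refl) cheap
    }
    where
    covers-by : Covers-by (proj₁ covering) (newPhase (u ∷ us))
    covers-by = subst Covering (sym (ℕ.+-identityʳ (proj₁ covering))) (proj₂ covering)
    open Outcome (busy ts (proj₁ covering) covers-by (search-new (u ∷ us) consistent fresh))

  busy [] fuel covers searching = sweep-now [] fuel covers searching [] _ refl refl
  busy (t ∷ ts) fuel {φ = φ} covers searching = Sum.[
      (λ t≤ → prepend (if-yes (t ≤? nextSweep φ) t≤)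
        (busy ts fuel {φ = record φ { members = members φ ⁺++ new }} covers (search-on searching t≤))) ,
      -- An epoch that coincides with the sweep goes first, so everything still to come arrives
      -- strictly later. This makes the members of the next phase strictly later than the end of
      -- this one.
      (λ t≰ → sweep-now (t ∷ ts) fuel covers searching
        (t≰ ∷ All.map (<-trans t≰) (AllPairs.head (AllPairs.tail ascending)))
        _ refl (if-no (t ≤? nextSweep φ) t≰))
    ]′ (toSum (t ≤? nextSweep φ))
    where
    open Searching searching
    open Epoch consistent

  sweep-now ts fuel covers searching next (just ls) eq step-eq =
    prepend-collection step-eq (idle ts idle-after)
    where open Sweep.Collection searching next eq
  sweep-now ts zero {s = s} covers searching next nothing eq step-eq =
    let q , _ , r<d = undiscovered eq in contradiction (covers s (location q)) r<d
    where open Sweep searching next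
  sweep-now ts (suc fuel) {φ = φ} covers searching next nothing eq step-eq =
    prepend-sweep step-eq (busy ts fuel {φ = φ′}
      (subst Covering (sym (ℕ.+-suc fuel (sweepsDone φ))) covers) (search-further eq))
    where open Sweep searching next

  arrivalTimes-∈ : ∀ q → arrival q ∈ Service.arrivalTimes I
  arrivalTimes-∈ q = ∈-resp-↭ (↭-sym (Sort.sort-↭ decTotalOrder _))
    (∈-deduplicate⁺ _≟_ (∈-map⁺ arrival (∈-allFin q)))

  arrivalTimes-nonneg : All (0# ≤_) (Service.arrivalTimes I)
  arrivalTimes-nonneg = All.tabulate nonneg
    where
    nonneg : ∀ {t} → t ∈ Service.arrivalTimes I → 0# ≤ t
    nonneg t∈ with ∈-map⁻ arrival (∈-deduplicate⁻ _≟_ (map arrival (allFin requests)) (∈-resp-↭ (Sort.sort-↭ decTotalOrder _) t∈))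
    ... | q , _ , refl = arrival≥0 q

  arrivalTimes-ascending : AllPairs _<_ (Service.arrivalTimes I)
  arrivalTimes-ascending = AllPairs.zipWith (λ (x≤y , x≢y) y≤x → x≢y (≤-antisym x≤y y≤x)) (sorted , unique)
    where
    sorted : AllPairs _≤_ (Service.arrivalTimes I)
    sorted = Linked⇒AllPairs ≤-trans (Sort.sort-↗ decTotalOrder _)
    unique : Unique (Service.arrivalTimes I)
    unique = Permutation.Unique-resp-↭ (setoid ℝ) (↭⇒↭ₛ (↭-sym (Sort.sort-↭ decTotalOrder _)))
      (Unique.deduplicate-! _≟_ (map arrival (allFin requests)))

  -- Starting at -1 makes arrivals at time 0 strictly later than the fictitious end of a previous
  -- phase.
  initial : Consistent (- 1#) (Service.arrivalTimes I) [] s₀ (- 1#) []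
  initial = record
    { ascending = All.map (λ 0≤t t≤-1 → 1≰0 (nonpositive (≤-trans 0≤t t≤-1))) arrivalTimes-nonneg ∷ arrivalTimes-ascending
    ; started   = ≤-refl
    ; arrived   = []
    ; tracked   = inj₂ ∘ inj₂ ∘ arrivalTimes-∈
    ; awaiting  = []
    }
    where
    nonpositive : 0# ≤ - 1# → 1# ≤ 0#
    nonpositive 0≤-1 = linear (0≤-1 +≤ ≤-reflexive (-‿inverseʳ 1#))
      (solve 2 (λ one m → (one ⊕ (m ⊕ ε)) ⊜ (ε ⊕ (ε ⊕ (one ⊕ m)))) refl _ _)

  competitive : ∃ λ ALG → Service.Performs I ALG × Service.Feasible I ALG × Service.cost I ALG ≤ 84 · Service.OPT I
  competitive = schedule , run , (Linked.tail ordered , legal) ,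
    ≤84·OPT chain (≤-trans (≤-reflexive (sym (+-identityˡ _))) cheap)
    where open Outcome (idle (Service.arrivalTimes I) initial)

theorem7p4 : (R : RealNumbers) (X : FiniteSubset R) (s₀ : Line.Site R X) →
    let open RealNumbers R
        open BlindElectiveService R X s₀
    in ∀ (I : Input) →
       ∃ λ ALG → Performs I ALG × Feasible I ALG × cost I ALG ≤ 84 · OPT I
theorem7p4 R X s₀ I = Algorithm.competitive R X s₀ I
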